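{- Let $X$ and $J$ be finite and let $f\in\mathcal L(X,J)$ be a generative formula. Then there is a continuum of distinct cells $C$ of $\Omega(X,J)$ that are dense in $\mathbf{Ck}(\{f\})$ and such that in $C$ there are infinitely many possibility sets of the cardinality of the continuum.
   Context: Formulas. $X$ (primitive propositions) and $J$ (agents) are finite sets. $\mathcal L=\mathcal L(X,J)$ is the smallest set of formulas containing $X$ and closed under $g\mapsto\neg g$, $(g,h)\mapsto g\wedge h$, and $g\mapsto k_jg$ for $j\in J$; $g\vee h$ and $g\to h$ are the usual abbreviations ($g\to h$ is $\neg g\vee h$). The multi-agent S5 logic has the rules modus ponens and necessitation (if $g$ is a theorem so is $k_jg$) and as axioms all substitution instances of propositional theorems, $(k_jg\wedge k_j(g\to h))\to k_jh$, $k_jg\to g$, $k_jg\to k_jk_jg$, $\neg k_jg\to k_j\neg k_jg$. A set of formulas is consistent if no finite subset leads to a contradiction in this logic, and complete if for each formula $g$ it contains $g$ or $\neg g$. $\Omega=\Omega(X,J)$ is the set of all complete and consistent subsets of $\mathcal L$. Partitions, cells, topology. For $j\in J$, $\mathcal Q^j$ is the partition of $\Omega$ in which $z,z'$ are equivalent iff $\{g: k_jg\in z\}=\{g:k_jg\in z'\}$. A possibility set is a member of some $\mathcal Q^j$. A cell is a member of the meet partition $\bigwedge_{j\in J}\mathcal Q^j$, i.e. a minimal non-empty $C\subseteq\Omega$ such that $P\in\mathcal Q^j$ and $P\cap C\neq\emptyset$ imply $P\subseteq C$, for all $j$. The topology of $\Omega$ has as base the sets $\{z\in\Omega: g\in z\}$,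 $g\in\mathcal L$. Let $E^0g=g$, $E g=\bigwedge_{j\in J}k_jg$, $E^{n}g=E(E^{n-1}g)$, and $\mathbf{Ck}(\{f\})=\{z\in\Omega: E^nf\in z\text{ for all }n\ge 0\}$. A cell $C$ is dense in $\mathbf{Ck}(\{f\})$ if $C\subseteq \mathbf{Ck}(\{f\})$ and $C$ is dense in it in the relative topology. Finite levels. Depth: $\mathrm{depth}(x)=0$ for $x\in X$, $\mathrm{depth}(\neg g)=\mathrm{depth}(g)$, $\mathrm{depth}(g\wedge h)=\max(\mathrm{depth}(g),\mathrm{depth}(h))$, $\mathrm{depth}(k_jg)=\mathrm{depth}(g)+1$. $\mathcal L_i$ is the set of formulas of depth $\le i$; $\Omega_i$ is the (finite) set of maximally consistent subsets of $\mathcal L_i$; $\pi_i:\Omega\to\Omega_i$, $\pi_i(z)=z\cap\mathcal L_i$ (surjective). $\mathcal G_i=\{\pi_i^{ -1}(w):w\in\Omega_i\}$. For $i\ge1$, $\overline{\mathcal F}_i^j$ is the partition of $\Omega_i$ in which $w,w'$ are equivalent iff $\{g\in\mathcal L_{i-1}:k_jg\in w\}=\{g\in\mathcal L_{i-1}:k_jg\in w'\}$; $\overline{\mathcal F}_0^j=\{\Omega_0\}$; $\mathcal F_i^j=\{\pi_i^{ -1}(B):B\in\overline{\mathcal F}_i^j\}$. For a formula $f$ of depth $d$, $\alpha^{\Omega_d}(f)=\{w\in\Omega_d:f\in w\}$. Generative formulas. For $i>0$ a non-empty $A\subseteq\Omega_i$ is semantically closed if for all $j\in J$, $B\in\mathcal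 G_{i-1}$, $w\in A$: if $\pi_i^{ -1}(w)\subseteq F\in\mathcal F_i^j$ and $F\cap B\ne\emptyset$ then $F\cap B\cap\pi_i^{ -1}(A)\neq\emptyset$. Every non-empty subset of $\Omega_0$ is semantically closed. A subset $A\subseteq\Omega_d$ is connected if any two of its elements are joined by a finite sequence in $A$ in which consecutive elements share a member of $\overline{\mathcal F}_d^j$ for some $j\in J$. A formula $f$ with $d=\mathrm{depth}(f)$ and $|J|\ge2$ is generative if $\alpha^{\Omega_d}(f)$ is semantically closed and connected, and there exists more than one cell dense in $\mathbf{Ck}(\{f\})$. -}

module Defs where

open import Level using (Level; 0ℓ; _⊔_) renaming (suc to lsuc)
open import Data.Bool using (Bool; true; false; not) renaming (_∧_ to _∧ᵇ_)
open import Data.Empty using (⊥)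
open import Data.Fin using (Fin) renaming (zero to fzero; suc to fsuc)
open import Data.List using (List; []; _∷_; foldr)
open import Data.List.Relation.Unary.All using (All; []; _∷_) renaming (map to All-map)
open import Data.Nat using (ℕ; zero; suc; _≤_) renaming (_⊔_ to _⊔ⁿ_)
open import Data.Product using (Σ; ∃; _×_; _,_; proj₁; proj₂; ∃-syntax)
open import Data.Sum using (_⊎_; inj₁; inj₂)
open import Data.Unit.Polymorphic using (⊤)
open import Function using (_∘_)
open import Function.Bundles using (Bijection; Injection)
open import Relation.Binary using (Rel; Setoid)
open import Relation.Binary.Construct.Closure.ReflexiveTransitive using (Star)
import Relation.Binary.Construct.On as On
open import Relation.Binary.PropositionalEquality using (_≡_; refl; _→-setoid_; setoid)
open import Relation.Nullary using (¬_; contradiction)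
open import Relation.Unary using (Pred; _∈_; _⊆_; _≐_; _∩_; _≬_; Satisfiable)
open import Relation.Unary.Relation.Binary.Equality using (≐-setoid)

private
  variable
    a ℓ ℓ₁ ℓ₂ : Level

------------------------------------------------------------------------
-- Sets, partitions and cardinality

-- Sets whose equality is not propositional are setoids; a subset of one
-- inherits its equality.
Subsetoid : (S : Setoid a ℓ₁) → Pred (Setoid.Carrier S) ℓ₂ → Setoid (a ⊔ ℓ₂) ℓ₁
Subsetoid S P = On.setoid {B = Σ (Setoid.Carrier S) P} S proj₁

Continuum : Setoid 0ℓ 0ℓ
Continuum = ℕ →-setoid Bool

HasCardinalityOfContinuum : Setoid a ℓ → Set (a ⊔ ℓ)
HasCardinalityOfContinuum S = Bijection Continuum S

Infinite : Setoid a ℓ → Set (a ⊔ ℓ)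
Infinite S = Injection (setoid ℕ) S

-- The partition of A into the classes of an equivalence relation R, as a
-- family of subsets of A.
Partition : {A : Set a} → Rel A ℓ₁ → Pred (Pred A ℓ₂) (a ⊔ ℓ₁ ⊔ ℓ₂)
Partition R P = ∃[ x ] P ≐ R x

------------------------------------------------------------------------
-- Formulas and the multi-agent S5 logic

infix  9 ~_
infixr 7 _∧_
infixr 6 _∨_
infixr 5 _⇒_

data Formula (X J : Set) : Set where
  atom : X → Formula X J
  ~_   : Formula X J → Formula X J
  _∧_  : Formula X J → Formula X J → Formula X J
  k    : J → Formula X J → Formula X J

_∨_ _⇒_ : ∀ {X J} → Formula X J → Formula X J → Formula X J
g ∨ h = ~ (~ g ∧ ~ h)
g ⇒ h = ~ g ∨ h

-- Propositional formulas, in countably many variables, are the formulas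
-- without agents.
PropFormula : Set
PropFormula = Formula ℕ ⊥

eval : (ℕ → Bool) → PropFormula → Bool
eval v (atom x) = v x
eval v (~ p)    = not (eval v p)
eval v (p ∧ q)  = eval v p ∧ᵇ eval v q

Tautology : PropFormula → Set
Tautology p = ∀ v → eval v p ≡ true

substitute : ∀ {X J} → (ℕ → Formula X J) → PropFormula → Formula X J
substitute σ (atom x) = σ x
substitute σ (~ p)    = ~ substitute σ p
substitute σ (p ∧ q)  = substitute σ p ∧ substitute σ q

infix 4 ⊢_

data ⊢_ {X J : Set} : Formula X J → Set where
  taut            : ∀ p σ → Tautology p → ⊢ substitute σ p
  distribution    : ∀ j g h → ⊢ (k j g ∧ k j (g ⇒ h)) ⇒ k j h
  truth           : ∀ j g → ⊢ k j g ⇒ g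
  pos-introspect  : ∀ j g → ⊢ k j g ⇒ k j (k j g)
  neg-introspect  : ∀ j g → ⊢ ~ k j g ⇒ k j (~ k j g)
  modus-ponens    : ∀ {g h} → ⊢ g ⇒ h → ⊢ g → ⊢ h
  necessitation   : ∀ {g} j → ⊢ g → ⊢ k j g

depth : ∀ {X J} → Formula X J → ℕ
depth (atom x) = 0
depth (~ g)    = depth g
depth (g ∧ h)  = depth g ⊔ⁿ depth h
depth (k j g)  = suc (depth g)

⋀ : ∀ {X J n} → (Fin (suc n) → Formula X J) → Formula X J
⋀ {n = zero}  g = g fzero
⋀ {n = suc n} g = g fzero ∧ ⋀ (g ∘ fsuc)

-- Without agents the conjunction is empty, i.e. a tautology.
E : ∀ {X n} → Formula X (Fin n) → Formula X (Fin n)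
E {n = zero}  g = g ∨ ~ g
E {n = suc n} g = ⋀ (λ j → k j g)

E^ : ∀ {X n} → ℕ → Formula X (Fin n) → Formula X (Fin n)
E^ zero    g = g
E^ (suc i) g = E (E^ i g)

------------------------------------------------------------------------
-- The space Ω

module _ {X J : Set} where

  -- The finite list Γ leads to a contradiction if, for some h, the formula
  -- g₁ ⇒ … ⇒ gₙ ⇒ (h ∧ ~ h) is a theorem.
  Contradictory : List (Formula X J) → Set
  Contradictory Γ = ∃[ h ] ⊢ foldr _⇒_ (h ∧ ~ h) Γ

  Consistent : Pred (Formula X J) ℓ → Set ℓ
  Consistent S = ∀ Γ → All S Γ → ¬ Contradictory Γ

  Complete : Pred (Formula X J) ℓ → Set ℓ
  Complete S = ∀ g → g ∈ S ⊎ ~ g ∈ S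

record Ω (X J : Set) : Set₁ where
  field
    set        : Pred (Formula X J) 0ℓ
    complete   : Complete set
    consistent : Consistent set

Ω-setoid : (X J : Set) → Setoid (lsuc 0ℓ) 0ℓ
Ω-setoid X J = On.setoid {B = Ω X J} (≐-setoid (Formula X J) 0ℓ) Ω.set

module _ {X J : Set} where

  infix 4 _∈ᶠ_

  _∈ᶠ_ : Formula X J → Ω X J → Set
  g ∈ᶠ z = g ∈ Ω.set z

  𝒬-equiv : J → Rel (Ω X J) 0ℓ
  𝒬-equiv j z z' = (λ g → k j g ∈ᶠ z) ≐ (λ g → k j g ∈ᶠ z')

  𝒬 : J → Pred (Pred (Ω X J) ℓ) (lsuc 0ℓ ⊔ ℓ)
  𝒬 j = Partition (𝒬-equiv j)

  -- Subsets of Ω are taken in Pred _ (lsuc 0ℓ), a level that contains the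
  -- reachability relation generated by all 𝒬-equiv j.
  Subset : Set₂
  Subset = Pred (Ω X J) (lsuc 0ℓ)

  IsPossibilitySet : Pred Subset (lsuc 0ℓ)
  IsPossibilitySet P = ∃[ j ] P ∈ 𝒬 j

  Saturated : Pred Subset (lsuc (lsuc 0ℓ))
  Saturated C = ∀ j (P : Subset) → P ∈ 𝒬 j → P ≬ C → P ⊆ C

  IsCell : Pred Subset (lsuc (lsuc 0ℓ))
  IsCell C = Satisfiable C × Saturated C
           × (∀ (D : Subset) → Satisfiable D → Saturated D → D ⊆ C → C ⊆ D)

  -- Open sets: unions of basic sets {z | g ∈ z}.
  IsOpen : Pred Subset (lsuc 0ℓ)
  IsOpen U = ∀ {z} → z ∈ U → ∃[ g ] (g ∈ᶠ z × (g ∈ᶠ_) ⊆ U)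

  DenseIn : Subset → Pred (Ω X J) ℓ → Set (lsuc (lsuc 0ℓ) ⊔ ℓ)
  DenseIn C K = C ⊆ K × (∀ (U : Subset) → IsOpen U → Satisfiable (U ∩ K) → (U ∩ K) ≬ C)

Ck : ∀ {X n} → Formula X (Fin n) → Pred (Ω X (Fin n)) 0ℓ
Ck f z = ∀ i → E^ i f ∈ᶠ z

------------------------------------------------------------------------
-- Finite levels

module _ {X J : Set} where

  ℒ : ℕ → Pred (Formula X J) 0ℓ
  ℒ i g = depth g ≤ i

record Ωₗ (X J : Set) (i : ℕ) : Set₁ where
  field
    set        : Pred (Formula X J) 0ℓ
    bounded    : set ⊆ ℒ i
    consistent : Consistent set
    maximal    : ∀ (T : Pred (Formula X J) 0ℓ) → T ⊆ ℒ i → Consistent T → set ⊆ T → T ⊆ set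

module _ {X J : Set} where

  _≈ₗ_ : ∀ {i} → Rel (Ωₗ X J i) 0ℓ
  w ≈ₗ w' = Ωₗ.set w ≐ Ωₗ.set w'

  private
    explosion : (g : Formula X J) → ⊢ g ⇒ ~ g ⇒ (g ∧ ~ g)
    explosion g = taut (p ⇒ ~ p ⇒ (p ∧ ~ p)) (λ _ → g) valid
      where
      p : PropFormula
      p = atom 0
      valid : Tautology (p ⇒ ~ p ⇒ (p ∧ ~ p))
      valid v with v 0
      ... | true  = refl
      ... | false = refl

  π : ∀ i → Ω X J → Ωₗ X J i
  π i z = record
    { set        = Ω.set z ∩ ℒ i
    ; bounded    = proj₂
    ; consistent = λ Γ Γ⊆ → Ω.consistent z Γ (All-map proj₁ Γ⊆)
    ; maximal    = maximal
    }
    where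
    maximal : ∀ T → T ⊆ ℒ i → Consistent T → (Ω.set z ∩ ℒ i) ⊆ T → T ⊆ (Ω.set z ∩ ℒ i)
    maximal T T⊆ℒ con z⊆T {g} g∈T with Ω.complete z g
    ... | inj₁ g∈z  = g∈z , T⊆ℒ g∈T
    ... | inj₂ ~g∈z = contradiction (g , explosion g)
                        (con (g ∷ ~ g ∷ []) (g∈T ∷ z⊆T (~g∈z , T⊆ℒ g∈T) ∷ []))

  π⁻¹ : ∀ i → Pred (Ωₗ X J i) ℓ → Pred (Ω X J) ℓ
  π⁻¹ i A = A ∘ π i

  fibre : ∀ {i} → Ωₗ X J i → Pred (Ω X J) 0ℓ
  fibre {i} w = π⁻¹ i (w ≈ₗ_)

  𝒢 : ℕ → Pred Subset (lsuc 0ℓ)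
  𝒢 i B = ∃[ w ] B ≐ fibre {i} w

  ℱ̄-equiv : ∀ i → J → Rel (Ωₗ X J i) 0ℓ
  ℱ̄-equiv zero    j w w' = ⊤
  ℱ̄-equiv (suc i) j w w' =
    (λ g → g ∈ ℒ i × k j g ∈ Ωₗ.set w) ≐ (λ g → g ∈ ℒ i × k j g ∈ Ωₗ.set w')

  ℱ̄ : ∀ i → J → Pred (Pred (Ωₗ X J i) (lsuc 0ℓ)) (lsuc 0ℓ)
  ℱ̄ i j = Partition (ℱ̄-equiv i j)

  ℱ : ℕ → J → Pred Subset (lsuc (lsuc 0ℓ))
  ℱ i j F = ∃[ B ] (B ∈ ℱ̄ i j × F ≐ π⁻¹ i B)

  α : ∀ i → Formula X J → Pred (Ωₗ X J i) 0ℓ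
  α i f w = f ∈ Ωₗ.set w

------------------------------------------------------------------------
-- Generative formulas

  FibreClosed : ∀ i → Pred (Ωₗ X J i) ℓ → Set (lsuc (lsuc 0ℓ) ⊔ ℓ)
  FibreClosed zero    A = ⊤
  FibreClosed (suc i) A =
    ∀ j (B : Subset) w → B ∈ 𝒢 i → w ∈ A →
    ∀ (F : Subset) → F ∈ ℱ (suc i) j → fibre w ⊆ F →
    F ≬ B → (F ∩ B) ≬ π⁻¹ (suc i) A

  SemanticallyClosed : ∀ i → Pred (Ωₗ X J i) ℓ → Set (lsuc (lsuc 0ℓ) ⊔ ℓ)
  SemanticallyClosed i A = Satisfiable A × FibreClosed i A

  Adjacent : ∀ i → Pred (Ωₗ X J i) ℓ → Rel (Ωₗ X J i) (lsuc (lsuc 0ℓ) ⊔ ℓ)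
  Adjacent i A w w' = w ∈ A × w' ∈ A × ∃[ j ] ∃[ B ] (B ∈ ℱ̄ i j × w ∈ B × w' ∈ B)

  Connected : ∀ i → Pred (Ωₗ X J i) ℓ → Set (lsuc (lsuc 0ℓ) ⊔ ℓ)
  Connected i A = ∀ w w' → w ∈ A → w' ∈ A → Star (Adjacent i A) w w'

module _ {X : Set} {n : ℕ} where

  IsDenseCell : Formula X (Fin n) → Pred Subset (lsuc (lsuc 0ℓ))
  IsDenseCell f C = IsCell C × DenseIn C (Ck f)

  record Generative (f : Formula X (Fin n)) : Set₂ where
    field
      two-agents          : 2 ≤ n
      semantically-closed : SemanticallyClosed (depth f) (α (depth f) f)
      connected           : Connected (depth f) (α (depth f) f)
      many-dense-cells    : ∃[ C ] ∃[ C' ]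
        (IsDenseCell f C × IsDenseCell f C' × ¬ C ≐ C')

module _ {X J : Set} where

  -- A possibility set of cardinality of the continuum contained in C.
  LargePossibilitySetIn : Subset {X} {J} → Pred Subset (lsuc 0ℓ)
  LargePossibilitySetIn C P = P ⊆ C × IsPossibilitySet P
    × HasCardinalityOfContinuum (Subsetoid (Ω-setoid X J) P)

  SubsetSetoid : Setoid (lsuc (lsuc 0ℓ)) (lsuc 0ℓ)
  SubsetSetoid = ≐-setoid (Ω X J) (lsuc 0ℓ)

  HasInfinitelyManyLargePossibilitySets : Pred Subset (lsuc (lsuc 0ℓ))
  HasInfinitelyManyLargePossibilitySets C =
    Infinite (Subsetoid SubsetSetoid (LargePossibilitySetIn C))

{-# OPTIONS --safe #-}

-- Let K = Ck({f}). A cell is a countable union of closed sets, namely of the sets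
-- of points reachable from a given point along a given word of agents. As two
-- different cells are dense in K, any two open sets meeting K can therefore be
-- shrunk so that no point of the second is reachable from a point of the first
-- along a given word, and a Cantor scheme of formulas yields a continuum of
-- points of K in pairwise different cells. The same scheme makes these points
-- generic: the cell of a generic point is dense in K, its possibility sets have
-- no isolated points, and the generic points are dense in each of them. Hence a
-- generic cell has a generic point in every open set meeting K, and these lie in
-- infinitely many possibility sets of a fixed agent, all homeomorphic to the
-- Cantor set.
--
-- That an isolated point of a possibility set of j can be destroyed by a small
-- perturbation is shown on Kripke models. Take two points of K which agree on all
-- subformulas of f and of a given u but not on some k i h, while they agree on
-- all subformulas of h. If i ≠ j, merging their j-classes preserves f, u and the
-- difference, and makes them equivalent for j. If i = j, merge instead their
-- classes for another agent b; removing afterwards one of the two points from the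
-- b-class of the other creates two points which differ in what b knows.

module Submission where

open import Defs
open import Axiom.ExcludedMiddle using (ExcludedMiddle)
open import Level using (Level; Lift; lift; lower; 0ℓ) renaming (suc to lsuc)
open import Data.Bool using (Bool; true; false; not; if_then_else_) renaming (_∧_ to _∧ᵇ_; _≟_ to _≟ᵇ_)
open import Data.Empty using (⊥-elim)
open import Data.Fin using (Fin; _≟_; toℕ) renaming (zero to fzero; suc to fsuc)
open import Data.Fin.Properties using (toℕ-injective)
open import Data.List using (List; []; _∷_; foldr; _++_; map; upTo; cartesianProduct)
open import Data.List.Membership.Propositional using () renaming (_∈_ to _∈ˡ_)
open import Data.List.Membership.Propositional.Properties using (∈-map⁺; ∈-++⁺ˡ; ∈-++⁺ʳ; ∈-cartesianProduct⁺; ∈-upTo⁺)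
open import Data.List.Relation.Unary.All as All using (All; []; _∷_)
open import Data.List.Relation.Unary.Any using (here)
open import Data.Nat using (ℕ; zero; suc; _+_; _*_; _<_; s≤s; _≤′_; ≤′-refl; ≤′-step)
open import Data.Nat.Properties using (m≤m+n; m≤n+m; ≤⇒≤′; ≤-refl; ≤-pred; m≤n⇒m<n∨m≡n; <-cmp; <-≤-trans;
  <-irrefl; +-monoʳ-≤; +-comm; *-suc; *-mono-≤; +-cancelˡ-≡; module ≤-Reasoning)
open import Data.Product using (_×_; Σ; Σ-syntax; ∃; ∃-syntax; _,_; proj₁; proj₂)
open import Data.Sum using (_⊎_; inj₁; inj₂; [_,_]′)
open import Data.Unit.Polymorphic using (⊤; tt)
open import Data.Vec using (Vec; []; _∷_; tail)
open import Data.Vec.Properties using (≡-dec; ∷-injective)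
open import Function using (_∘_; id)
open import Relation.Binary using (DecidableEquality; tri<; tri≈; tri>)
open import Relation.Binary.PropositionalEquality using (_≡_; _≢_; refl; sym; trans; cong; cong₂; subst)
open import Relation.Nullary using (¬_; Dec; yes; no; does)
open import Relation.Nullary.Decidable using (True; toWitness; fromWitness; decidable-stable; dec-true)
open import Relation.Unary using (Pred; _∈_; _≐_; _⊆_)

private
  variable
    a b ℓ ℓ₁ ℓ₂ : Level
    X J : Set

-- Propositional tautologies in three variables

private
  both : (Bool → Bool) → Bool
  both ψ = ψ true ∧ᵇ ψ false

  both-sound : (ψ : Bool → Bool) → both ψ ≡ true → ∀ x → ψ x ≡ true
  both-sound ψ eq true  with true ← ψ true = refl
  both-sound ψ eq false with true ← ψ true = eq

  everywhere : (Bool → Bool → Bool → Bool) → Bool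
  everywhere φ = both λ x → both λ y → both λ z → φ x y z

  everywhere-sound : ∀ φ → everywhere φ ≡ true → ∀ x y z → φ x y z ≡ true
  everywhere-sound φ eq x y z =
    both-sound (φ x y) (both-sound (λ y → both (φ x y))
      (both-sound (λ x → both λ y → both (φ x y)) eq x) y) z

  triple : ∀ {A : Set} → A → A → A → ℕ → A
  triple x y z 0 = x
  triple x y z 1 = y
  triple x y z _ = z

  p q r : PropFormula
  p = atom 0
  q = atom 1
  r = atom 2

  -- Validity ranges over all valuations of countably many variables. Once `local` says that only
  -- the first three values matter, eight cases remain, and these are checked by computation.
  tautology : ∀ t → (∀ v → eval v t ≡ eval (triple (v 0) (v 1) (v 2)) t) →
              everywhere (λ x y z → eval (triple x y z) t) ≡ true →
              (g h c : Formula X J) → ⊢ substitute (triple g h c) t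
  tautology t local eq g h c = taut t (triple g h c) λ v →
    trans (local v) (everywhere-sound (λ x y z → eval (triple x y z) t) eq (v 0) (v 1) (v 2))

module _ {X J : Set} where

  F : Set
  F = Formula X J

  weakening : (g h : F) → ⊢ g ⇒ h ⇒ g
  weakening g h = tautology (p ⇒ q ⇒ p) (λ _ → refl) refl g h h

  cut : (g h c : F) → ⊢ (g ⇒ h) ⇒ (g ⇒ h ⇒ c) ⇒ g ⇒ c
  cut = tautology ((p ⇒ q) ⇒ (p ⇒ q ⇒ r) ⇒ p ⇒ r) (λ _ → refl) refl

  identity : (g : F) → ⊢ g ⇒ g
  identity g = tautology (p ⇒ p) (λ _ → refl) refl g g g

  transitivity : (g h c : F) → ⊢ (g ⇒ h) ⇒ (h ⇒ c) ⇒ g ⇒ c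
  transitivity = tautology ((p ⇒ q) ⇒ (q ⇒ r) ⇒ p ⇒ r) (λ _ → refl) refl

  refutation : (g h : F) → ⊢ (g ⇒ h ∧ ~ h) ⇒ ~ g
  refutation g h = tautology ((p ⇒ q ∧ ~ q) ⇒ ~ p) (λ _ → refl) refl g h h

  projectionˡ : (g h : F) → ⊢ g ∧ h ⇒ g
  projectionˡ g h = tautology (p ∧ q ⇒ p) (λ _ → refl) refl g h h

  projectionʳ : (g h : F) → ⊢ g ∧ h ⇒ h
  projectionʳ g h = tautology (p ∧ q ⇒ q) (λ _ → refl) refl g h h

  pairing : (g h : F) → ⊢ g ⇒ h ⇒ g ∧ h
  pairing g h = tautology (p ⇒ q ⇒ p ∧ q) (λ _ → refl) refl g h h

  exclusion⁺ : (g h : F) → ⊢ ~ (g ∧ ~ h) ⇒ g ⇒ h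
  exclusion⁺ g h = tautology (~ (p ∧ ~ q) ⇒ p ⇒ q) (λ _ → refl) refl g h h

  exclusion⁻ : (g h : F) → ⊢ ~ (g ∧ h) ⇒ g ⇒ ~ h
  exclusion⁻ g h = tautology (~ (p ∧ q) ⇒ p ⇒ ~ q) (λ _ → refl) refl g h h

  cases : (g h : F) → ⊢ ~ (g ∧ h) ⇒ ~ (g ∧ ~ h) ⇒ ~ g
  cases g h = tautology (~ (p ∧ q) ⇒ ~ (p ∧ ~ q) ⇒ ~ p) (λ _ → refl) refl g h h

  double-negation : (g : F) → ⊢ ~ ~ g ⇒ g
  double-negation g = tautology (~ ~ p ⇒ p) (λ _ → refl) refl g g g

  explosion : (g h : F) → ⊢ ~ g ⇒ g ⇒ h
  explosion g h = tautology (~ p ⇒ p ⇒ q) (λ _ → refl) refl g h h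

  detachment : (g h : F) → ⊢ (g ⇒ h) ⇒ g ⇒ ~ h ⇒ h ∧ ~ h
  detachment g h = tautology ((p ⇒ q) ⇒ p ⇒ ~ q ⇒ q ∧ ~ q) (λ _ → refl) refl g h h

-- Points of `Ω` and deductively closed theories

record Theory (X J : Set) : Set₁ where
  field
    set     : Pred (Formula X J) 0ℓ
    theorem : ∀ {g} → ⊢ g → set g
    detach  : ∀ {g h} → set (g ⇒ h) → set g → set h

  -- A theory stands for the closed set of points that contain it. By `lindenbaum`, `h` is possible
  -- exactly when the basic set of `h` meets this closed set.
  Possible : Formula X J → Set
  Possible h = ¬ set (~ h)

  Decides : Formula X J → Formula X J → Set
  Decides h g = set (h ⇒ g) ⊎ set (h ⇒ ~ g)

open Theory using (Possible; Decides)

infix 4 _⊆Ω_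
_⊆Ω_ : Theory X J → Ω X J → Set
T ⊆Ω z = ∀ {g} → Theory.set T g → g ∈ᶠ z

module _ {X J : Set} where

  private
    variable
      z y : Ω X J
      g h : Formula X J
      j : J

  ∈-theorem : (z : Ω X J) → ⊢ g → g ∈ᶠ z
  ∈-theorem {g} z ⊢g with Ω.complete z g
  ... | inj₁ g∈ = g∈
  ... | inj₂ ~g∈ = ⊥-elim (Ω.consistent z (~ g ∷ []) (~g∈ ∷ [])
                     (g , modus-ponens (pairing g (~ g)) ⊢g))

  ∈-detach : (z : Ω X J) → g ⇒ h ∈ᶠ z → g ∈ᶠ z → h ∈ᶠ z
  ∈-detach {g} {h} z g⇒h∈ g∈ with Ω.complete z h
  ... | inj₁ h∈ = h∈
  ... | inj₂ ~h∈ = ⊥-elim (Ω.consistent z ((g ⇒ h) ∷ g ∷ ~ h ∷ []) (g⇒h∈ ∷ g∈ ∷ ~h∈ ∷ [])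
                     (h , detachment g h))

  ∈-apply : (z : Ω X J) → ⊢ g ⇒ h → g ∈ᶠ z → h ∈ᶠ z
  ∈-apply z ⊢g⇒h = ∈-detach z (∈-theorem z ⊢g⇒h)

  ∉-~ : (z : Ω X J) → ~ g ∈ᶠ z → ¬ g ∈ᶠ z
  ∉-~ {g} z ~g∈ g∈ = Ω.consistent z (g ∷ ~ g ∷ []) (g∈ ∷ ~g∈ ∷ []) (g , pairing g (~ g))

  ∈-~ : (z : Ω X J) → ¬ g ∈ᶠ z → ~ g ∈ᶠ z
  ∈-~ {g} z g∉ with Ω.complete z g
  ... | inj₁ g∈  = ⊥-elim (g∉ g∈)
  ... | inj₂ ~g∈ = ~g∈

  _∈?_ : ∀ g (z : Ω X J) → Dec (g ∈ᶠ z)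
  g ∈? z with Ω.complete z g
  ... | inj₁ g∈  = yes g∈
  ... | inj₂ ~g∈ = no (∉-~ z ~g∈)

  ∈-∧ : (z : Ω X J) → g ∈ᶠ z → h ∈ᶠ z → g ∧ h ∈ᶠ z
  ∈-∧ {g} {h} z g∈ h∈ = ∈-detach z (∈-apply z (pairing g h) g∈) h∈

  ∈-∧ˡ : (z : Ω X J) → g ∧ h ∈ᶠ z → g ∈ᶠ z
  ∈-∧ˡ {g} {h} z = ∈-apply z (projectionˡ g h)

  ∈-∧ʳ : (z : Ω X J) → g ∧ h ∈ᶠ z → h ∈ᶠ z
  ∈-∧ʳ {g} {h} z = ∈-apply z (projectionʳ g h)

  ∈-⇒ : (z : Ω X J) → (g ∈ᶠ z → h ∈ᶠ z) → g ⇒ h ∈ᶠ z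
  ∈-⇒ {g} {h} z imp with g ∈? z
  ... | yes g∈ = ∈-apply z (weakening h g) (imp g∈)
  ... | no  g∉ = ∈-apply z (explosion g h) (∈-~ z g∉)

  possible : (T : Theory X J) (z : Ω X J) → T ⊆Ω z → g ∈ᶠ z → Possible T g
  possible T z T⊆z g∈ ~g∈T = ∉-~ z (T⊆z ~g∈T) g∈

  -- Points are complete and consistent, so none properly contains another.
  ∉-⊆ : {z y : Ω X J} → (∀ {g} → g ∈ᶠ z → g ∈ᶠ y) → ∀ {g} → g ∈ᶠ y → g ∈ᶠ z
  ∉-⊆ {z} {y} z⊆y {g} g∈y with g ∈? z
  ... | yes g∈ = g∈
  ... | no  g∉ = ⊥-elim (∉-~ y (z⊆y (∈-~ z g∉)) g∈y)

  theory-of-knowledge : J → Ω X J → Theory X J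
  theory-of-knowledge j z = record
    { set     = λ g → k j g ∈ᶠ z
    ; theorem = λ ⊢g → ∈-theorem z (necessitation j ⊢g)
    ; detach  = λ {g} {h} kgh kg → ∈-apply z (distribution j g h) (∈-∧ z kg kgh)
    }

  ≈-refl : ∀ j (z : Ω X J) → 𝒬-equiv j z z
  ≈-refl j z = (λ w → w) , (λ w → w)

  ≈-sym : ∀ j (z y : Ω X J) → 𝒬-equiv j z y → 𝒬-equiv j y z
  ≈-sym j z y (z⊆y , y⊆z) = y⊆z , z⊆y

  ≈-trans : ∀ j (x z y : Ω X J) → 𝒬-equiv j x z → 𝒬-equiv j z y → 𝒬-equiv j x y
  ≈-trans j x z y (a , b) (c , d) = (λ w → c (a w)) , (λ w → b (d w))

  -- By introspection `k j g` and `~ k j g` are known to `j` wherever they hold, so containing what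
  -- is known at `z` already fixes all knowledge of `j`. Hence a possibility set is the closed set
  -- of a theory.
  knowledge⇒≈ : (z y : Ω X J) → theory-of-knowledge j z ⊆Ω y → 𝒬-equiv j z y
  knowledge⇒≈ {j} z y z⊆y =
      (λ {g} kg∈z → z⊆y (∈-apply z (pos-introspect j g) kg∈z))
    , λ {g} kg∈y → back (k j g ∈? z) kg∈y
    where
    back : ∀ {g} → Dec (k j g ∈ᶠ z) → k j g ∈ᶠ y → k j g ∈ᶠ z
    back (yes kg∈z) _ = kg∈z
    back {g} (no kg∉z) kg∈y =
      ⊥-elim (∉-~ y (z⊆y (∈-apply z (neg-introspect j g) (∈-~ z kg∉z))) kg∈y)

  ≈⇒knowledge : (z y : Ω X J) → 𝒬-equiv j z y → theory-of-knowledge j z ⊆Ω y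
  ≈⇒knowledge {j} z y (z⊆y , _) {g} kg∈z = ∈-apply y (truth j g) (z⊆y kg∈z)

  ◇ : J → Formula X J → Formula X J
  ◇ j g = ~ k j (~ g)

  ∈-◇ : (z y : Ω X J) → 𝒬-equiv j z y → g ∈ᶠ y → ◇ j g ∈ᶠ z
  ∈-◇ z y z≈y g∈y = ∈-~ z λ k∈z → ∉-~ y (≈⇒knowledge z y z≈y k∈z) g∈y

-- Limits, Baire category and completeness of the logic

module Classical (em : ∀ {ℓ} → ExcludedMiddle ℓ) {X J : Set}
                 (e : ℕ → Formula X J) (e-onto : ∀ g → ∃[ i ] e i ≡ g) where

  module _ (T : Theory X J) where
    open Theory T using (set) renaming (theorem to thm; detach to _·_)

    Descending : (ℕ → Formula X J) → Set
    Descending h = ∀ m → set (h (suc m) ⇒ h m)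

    compose : ∀ {g h c} → set (g ⇒ h) → set (h ⇒ c) → set (g ⇒ c)
    compose a b = (thm (transitivity _ _ _) · a) · b

    cut-all : ∀ {M c} {Γ} → All (λ g → set (M ⇒ g)) Γ → set (M ⇒ foldr _⇒_ c Γ) → set (M ⇒ c)
    cut-all []       M⇒c = M⇒c
    cut-all (M⇒g ∷ Γ) M⇒ = cut-all Γ ((thm (cut _ _ _) · M⇒g) · M⇒)

    descend : ∀ {h} → Descending h → ∀ {m n g} → m ≤′ n → set (h m ⇒ g) → set (h n ⇒ g)
    descend ↓h ≤′-refl       hm⇒g = hm⇒g
    descend ↓h (≤′-step m≤n) hm⇒g = compose (↓h _) (descend ↓h m≤n hm⇒g)

    gather : ∀ {h} → Descending h → ∀ {Γ} → All (λ g → ∃[ m ] set (h m ⇒ g)) Γ →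
             ∃[ M ] All (λ g → set (h M ⇒ g)) Γ
    gather ↓h [] = 0 , []
    gather ↓h ((m , hm⇒g) ∷ Γ) with M , all ← gather ↓h Γ =
      m + M , descend ↓h (≤⇒≤′ (m≤m+n m M)) hm⇒g ∷ All.map (descend ↓h (≤⇒≤′ (m≤n+m M m))) all

    -- The limit consists of the consequences over `T` of the formulas `h m`. Finitely many of them
    -- follow from a single `h M`, which gives consistency. The last component makes the limit the
    -- only point containing `T` and every `h m`.
    limit : ∀ h → Descending h → (∀ m → Possible T (h m)) → (∀ m → Decides T (h (suc m)) (e m)) →
            Σ[ z ∈ Ω X J ] T ⊆Ω z × (∀ m → h m ∈ᶠ z) × (∀ {g} → g ∈ᶠ z → ∃[ m ] set (h m ⇒ g))
    limit h ↓h possible-h decided = z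
      , (λ g∈T → 0 , (thm (weakening _ _) · g∈T))
      , (λ m → m , thm (identity _))
      , (λ g∈z → g∈z)
      where
      z : Ω X J
      z = record
        { set        = λ g → ∃[ m ] set (h m ⇒ g)
        ; complete   = complete
        ; consistent = consistent
        }
        where
        complete : Complete (λ g → ∃[ m ] set (h m ⇒ g))
        complete g with i , refl ← e-onto g with decided i
        ... | inj₁ h⇒g  = inj₁ (suc i , h⇒g)
        ... | inj₂ h⇒~g = inj₂ (suc i , h⇒~g)
        consistent : Consistent (λ g → ∃[ m ] set (h m ⇒ g))
        consistent Γ all (c , contradictory) with M , all′ ← gather ↓h all =
          possible-h M (thm (refutation _ c) · cut-all all′ (thm (weakening _ _) · thm contradictory))

    possible-split : ∀ {h} g → Possible T h → Possible T (h ∧ g) ⊎ Possible T (h ∧ ~ g)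
    possible-split {h} g possible-h with em {P = Possible T (h ∧ g)} | em {P = Possible T (h ∧ ~ g)}
    ... | yes poss | _        = inj₁ poss
    ... | no _     | yes poss = inj₂ poss
    ... | no ¬poss | no ¬poss′ = ⊥-elim (possible-h
            ((thm (cases h g) · decidable-stable em ¬poss) · decidable-stable em ¬poss′))

    decide : ∀ {h} g → Possible T h → ∃[ x ] Possible T (h ∧ x) × Decides T (h ∧ x) g
    decide g possible-h with possible-split g possible-h
    ... | inj₁ poss = g , poss , inj₁ (thm (projectionʳ _ _))
    ... | inj₂ poss = ~ g , poss , inj₂ (thm (projectionʳ _ _))

    decides-∧ : ∀ {h x g} → Decides T h g → Decides T (h ∧ x) g
    decides-∧ (inj₁ h⇒g)  = inj₁ (compose (thm (projectionˡ _ _)) h⇒g)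
    decides-∧ (inj₂ h⇒~g) = inj₂ (compose (thm (projectionˡ _ _)) h⇒~g)

    -- The Baire category theorem for the compact set of points containing T.
    opaque
      fusion : ∀ {ℓ} (D : ℕ → Formula X J → Set ℓ) →
               (∀ m {h} → Possible T h → ∃[ x ] Possible T (h ∧ x) × D m (h ∧ x)) →
               ∀ {h} → Possible T h →
               Σ[ z ∈ Ω X J ] T ⊆Ω z × h ∈ᶠ z × (∀ m → ∃[ g ] g ∈ᶠ z × D m g)
      fusion D dense {h₀} possible-h₀ =
        let z , T⊆z , h∈z , _ = limit (λ m → proj₁ (seq m)) (λ m → proj₁ (proj₂ (next m (seq m))))
                                  (λ m → proj₂ (seq m)) (λ m → proj₁ (proj₂ (proj₂ (next m (seq m)))))
        in z , T⊆z , h∈z 0 , λ m → _ , h∈z (suc m) , proj₂ (proj₂ (proj₂ (next m (seq m))))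
        where
        next : ∀ m (s : ∃ (Possible T)) → Σ[ s′ ∈ ∃ (Possible T) ]
                 set (proj₁ s′ ⇒ proj₁ s) × Decides T (proj₁ s′) (e m) × D m (proj₁ s′)
        next m (h , possible-h)
          with x , possible-hx , decides ← decide (e m) possible-h
          with y , possible-hxy , d ← dense m possible-hx =
            (((h ∧ x) ∧ y) , possible-hxy)
          , compose (thm (projectionˡ _ _)) (thm (projectionˡ _ _)) , decides-∧ decides , d
        seq : ℕ → ∃ (Possible T)
        seq zero    = h₀ , possible-h₀
        seq (suc m) = proj₁ (next m (seq m))

    opaque
      lindenbaum : ∀ {h} → Possible T h → Σ[ z ∈ Ω X J ] T ⊆Ω z × h ∈ᶠ z
      lindenbaum possible-h =
        let z , T⊆z , h∈z , _ = fusion (λ _ _ → ⊤ {0ℓ}) (λ m possible-h →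
                                  let x , possible-hx , _ = decide (e m) possible-h
                                  in x , possible-hx , tt) possible-h
        in z , T⊆z , h∈z

    entailed : ∀ {g} → (∀ z → T ⊆Ω z → g ∈ᶠ z) → set g
    entailed {g} valid with em {P = set g}
    ... | yes g∈T = g∈T
    ... | no g∉T with z , T⊆z , ~g∈z ← lindenbaum {~ g} (λ ~~g → g∉T (thm (double-negation g) · ~~g)) =
      ⊥-elim (∉-~ z ~g∈z (valid z T⊆z))

  theorems : Theory X J
  theorems = record { set = ⊢_ ; theorem = λ ⊢g → ⊢g ; detach = modus-ponens }

  completeness : ∀ {g} → (∀ z → g ∈ᶠ z) → ⊢ g
  completeness valid = entailed theorems (λ z _ → valid z)

  k-mono : ∀ {j g h} (z : Ω X J) → (∀ y → g ∈ᶠ y → h ∈ᶠ y) → k j g ∈ᶠ z → k j h ∈ᶠ z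
  k-mono {j} {g} {h} z g⊆h kg∈z =
    ∈-apply z (distribution j g h)
      (∈-∧ z kg∈z (∈-theorem z (necessitation j (completeness λ y → ∈-⇒ y (g⊆h y)))))

  opaque
    ◇-witness : ∀ {j g} (z : Ω X J) → ◇ j g ∈ᶠ z → Σ[ y ∈ Ω X J ] 𝒬-equiv j z y × g ∈ᶠ y
    ◇-witness {j} {g} z ◇g∈z
      with y , z⊆y , g∈y ← lindenbaum (theory-of-knowledge j z) {g} (∉-~ z ◇g∈z) =
      y , knowledge⇒≈ z y z⊆y , g∈y

  opaque
    unknown-witness : ∀ {j g} (z : Ω X J) → ¬ k j g ∈ᶠ z → Σ[ y ∈ Ω X J ] 𝒬-equiv j z y × ¬ g ∈ᶠ y
    unknown-witness {j} {g} z kg∉z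
      with y , z≈y , ~g∈y ← ◇-witness z (∈-~ z λ k∈z → kg∉z
             (k-mono z (λ y ~~g∈y → ∈-apply y (double-negation g) ~~g∈y) k∈z)) =
      y , z≈y , ∉-~ y ~g∈y

-- Agreement of points on subformulas

Agree : Ω X J → Ω X J → Formula X J → Set
Agree z y g = (g ∈ᶠ z → g ∈ᶠ y) × (g ∈ᶠ y → g ∈ᶠ z)

-- Agreement on `g` and all its subformulas. Atoms and knowledge formulas suffice, as Boolean
-- connectives preserve agreement.
Alike : Ω X J → Ω X J → Formula X J → Set
Alike z y (atom x) = Agree z y (atom x)
Alike z y (~ g)    = Alike z y g
Alike z y (g ∧ h)  = Alike z y g × Alike z y h
Alike z y (k j g)  = Alike z y g × Agree z y (k j g)

-- Truth in a labelled Kripke model can deviate from the labels only at knowledge formulas, so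
-- conditions are imposed on these subformulas alone.
Modally : (J → Formula X J → Set ℓ) → Formula X J → Set ℓ
Modally B (atom x) = ⊤
Modally B (~ g)    = Modally B g
Modally B (g ∧ h)  = Modally B g × Modally B h
Modally B (k j g)  = Modally B g × B j g

module _ {X J : Set} where

  private
    variable
      z y x : Ω X J

  agree-sym : ∀ z y g → Agree {X} {J} z y g → Agree y z g
  agree-sym _ _ _ (a , b) = b , a

  agree-trans : ∀ z y x g → Agree {X} {J} z y g → Agree y x g → Agree z x g
  agree-trans _ _ _ _ (a , b) (c , d) = (λ w → c (a w)) , (λ w → b (d w))

  agree-~ : ∀ z y {g} → Agree z y g → Agree {X} {J} z y (~ g)
  agree-~ z y (z⊆y , y⊆z) =
      (λ ~g∈z → ∈-~ y λ g∈y → ∉-~ z ~g∈z (y⊆z g∈y))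
    , (λ ~g∈y → ∈-~ z λ g∈z → ∉-~ y ~g∈y (z⊆y g∈z))

  agree-∧ : ∀ z y {g h} → Agree z y g → Agree z y h → Agree {X} {J} z y (g ∧ h)
  agree-∧ z y (a , b) (c , d) =
      (λ w → ∈-∧ y (a (∈-∧ˡ z w)) (c (∈-∧ʳ z w)))
    , (λ w → ∈-∧ z (b (∈-∧ˡ y w)) (d (∈-∧ʳ y w)))

  alike⇒agree : ∀ z y g → Alike {X} {J} z y g → Agree z y g
  alike⇒agree z y (atom x) a       = a
  alike⇒agree z y (~ g)    a       = agree-~ z y (alike⇒agree z y g a)
  alike⇒agree z y (g ∧ h)  (a , b) = agree-∧ z y (alike⇒agree z y g a) (alike⇒agree z y h b)
  alike⇒agree z y (k j g)  (_ , a) = a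

  alike-sym : ∀ {z y} g → Alike {X} {J} z y g → Alike y z g
  alike-sym (atom x) (a , b)             = b , a
  alike-sym (~ g)    a                   = alike-sym g a
  alike-sym (g ∧ h)  (a , b)             = alike-sym g a , alike-sym h b
  alike-sym (k j g)  (a , b , c) = alike-sym g a , c , b

  alike-trans : ∀ {z y x} g → Alike {X} {J} z y g → Alike y x g → Alike z x g
  alike-trans {z} {y} {x} (atom v) a b = agree-trans z y x (atom v) a b
  alike-trans (~ g)    a b             = alike-trans g a b
  alike-trans (g ∧ h)  (a , a′) (b , b′) = alike-trans g a b , alike-trans h a′ b′
  alike-trans {z} {y} {x} (k j g) (a , a′) (b , b′) =
    alike-trans g a b , agree-trans z y x (k j g) a′ b′

  modally-map : ∀ (B : J → Formula X J → Set ℓ₁) (B′ : J → Formula X J → Set ℓ₂) →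
                (∀ j g → B j g → B′ j g) → ∀ g → Modally B g → Modally B′ g
  modally-map B B′ f (atom x) b        = tt
  modally-map B B′ f (~ g)    b        = modally-map B B′ f g b
  modally-map B B′ f (g ∧ h)  (b , b′) = modally-map B B′ f g b , modally-map B B′ f h b′
  modally-map B B′ f (k j g)  (b , b′) = modally-map B B′ f g b , f j g b′

  alike⇒modally : ∀ z y g → Alike {X} {J} z y g → Modally (λ j h → Agree z y (k j h)) g
  alike⇒modally z y (atom x) a       = tt
  alike⇒modally z y (~ g)    a       = alike⇒modally z y g a
  alike⇒modally z y (g ∧ h)  (a , b) = alike⇒modally z y g a , alike⇒modally z y h b
  alike⇒modally z y (k j g)  (a , b) = alike⇒modally z y g a , b

  literal : Ω X J → Formula X J → Formula X J
  literal z g = if does (g ∈? z) then g else ~ g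

  literal-∈ : ∀ z g → literal z g ∈ᶠ z
  literal-∈ z g with g ∈? z
  ... | yes g∈ = g∈
  ... | no  g∉ = ∈-~ z g∉

  literal⇒agree : ∀ z y g → literal z g ∈ᶠ y → Agree z y g
  literal⇒agree z y g with g ∈? z
  ... | yes g∈z = λ g∈y → (λ _ → g∈y) , (λ _ → g∈z)
  ... | no  g∉z = λ ~g∈y → (λ g∈z → ⊥-elim (g∉z g∈z)) , (λ g∈y → ⊥-elim (∉-~ y ~g∈y g∈y))

  -- The characteristic formula of the points `Alike` to `z` on `g`.
  portrait : Ω X J → Formula X J → Formula X J
  portrait z (atom x) = literal z (atom x)
  portrait z (~ g)    = portrait z g
  portrait z (g ∧ h)  = portrait z g ∧ portrait z h
  portrait z (k j g)  = portrait z g ∧ literal z (k j g)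

  portrait-∈ : ∀ z g → portrait z g ∈ᶠ z
  portrait-∈ z (atom x) = literal-∈ z (atom x)
  portrait-∈ z (~ g)    = portrait-∈ z g
  portrait-∈ z (g ∧ h)  = ∈-∧ z (portrait-∈ z g) (portrait-∈ z h)
  portrait-∈ z (k j g)  = ∈-∧ z (portrait-∈ z g) (literal-∈ z (k j g))

  portrait⇒alike : ∀ z y g → portrait z g ∈ᶠ y → Alike z y g
  portrait⇒alike z y (atom x) χ = literal⇒agree z y (atom x) χ
  portrait⇒alike z y (~ g)    χ = portrait⇒alike z y g χ
  portrait⇒alike z y (g ∧ h)  χ = portrait⇒alike z y g (∈-∧ˡ y χ) , portrait⇒alike z y h (∈-∧ʳ y χ)
  portrait⇒alike z y (k j g)  χ =
    portrait⇒alike z y g (∈-∧ˡ y χ) , literal⇒agree z y (k j g) (∈-∧ʳ y χ)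

  literal-alike : ∀ z {y x} g → Alike y x g → Alike y x (literal z g)
  literal-alike z g a with g ∈? z
  ... | yes _ = a
  ... | no  _ = a

  -- A portrait has no atoms or knowledge subformulas beyond those of `g`.
  portrait-alike : ∀ z {y x} g → Alike y x g → Alike y x (portrait z g)
  portrait-alike z (atom x) a       = literal-alike z (atom x) a
  portrait-alike z (~ g)    a       = portrait-alike z g a
  portrait-alike z (g ∧ h)  (a , b) = portrait-alike z g a , portrait-alike z h b
  portrait-alike z (k j g)  (a , b) = portrait-alike z g a , literal-alike z (k j g) (a , b)

-- Kripke models

module Kripke (em : ∀ {ℓ} → ExcludedMiddle ℓ) {X J : Set} {a b : Level}
              (W : Set a) (τ : W → Ω X J) (R : J → W → W → Set b)
              (R-refl : ∀ j w → R j w w)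
              (R-sym : ∀ j w v → R j w v → R j v w)
              (R-trans : ∀ j w v u → R j w v → R j v u → R j w u) where

  -- Truth is Boolean-valued, with excluded middle deciding knowledge formulas. Tautologies can then
  -- be evaluated by `eval`, and the theory of a world is a small set of formulas even if the worlds
  -- are themselves points of `Ω`.
  sat : W → Formula X J → Bool
  sat w (atom x) = does (atom x ∈? τ w)
  sat w (~ g)    = not (sat w g)
  sat w (g ∧ h)  = sat w g ∧ᵇ sat w h
  sat w (k j g)  = does (em {P = ∀ v → R j w v → sat v g ≡ true})

  private
    infix 4 _⊨_
    _⊨_ : W → Formula X J → Set
    w ⊨ g = sat w g ≡ true

    does⇒ : ∀ {P : Set ℓ} (P? : Dec P) → does P? ≡ true → P
    does⇒ (yes p) _ = p

    imp : ∀ b c → (b ≡ true → c ≡ true) → not (not (not b) ∧ᵇ not c) ≡ true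
    imp true  true  _   = refl
    imp true  false b→c with () ← b→c refl
    imp false _     _   = refl

    imp⁻ : ∀ b c → not (not (not b) ∧ᵇ not c) ≡ true → b ≡ true → c ≡ true
    imp⁻ true true _ _ = refl

    and⁻ : ∀ b c → b ∧ᵇ c ≡ true → b ≡ true × c ≡ true
    and⁻ true true _ = refl , refl

    not⁻ : ∀ b → not b ≡ true → b ≢ true
    not⁻ false _ ()

    not⁺ : ∀ b → b ≢ true → not b ≡ true
    not⁺ true  b≢ = ⊥-elim (b≢ refl)
    not⁺ false _  = refl

    ⊨k⁺ : ∀ {j w} g → (∀ v → R j w v → v ⊨ g) → w ⊨ k j g
    ⊨k⁺ g = dec-true em

    ⊨k⁻ : ∀ {j w} g → w ⊨ k j g → ∀ v → R j w v → v ⊨ g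
    ⊨k⁻ g = does⇒ em

    sat-substitute : ∀ w σ t → sat w (substitute σ t) ≡ eval (λ n → sat w (σ n)) t
    sat-substitute w σ (atom n) = refl
    sat-substitute w σ (~ t)    = cong not (sat-substitute w σ t)
    sat-substitute w σ (t ∧ u)  = cong₂ _∧ᵇ_ (sat-substitute w σ t) (sat-substitute w σ u)

  sound : ∀ {g} → ⊢ g → ∀ w → w ⊨ g
  sound (taut t σ valid) w = trans (sat-substitute w σ t) (valid _)
  sound (distribution j g h) w = imp _ (sat w (k j h)) λ eq →
    let kg , kgh = and⁻ _ (sat w (k j (g ⇒ h))) eq
    in ⊨k⁺ h λ v wRv → imp⁻ (sat v g) (sat v h) (⊨k⁻ (g ⇒ h) kgh v wRv) (⊨k⁻ g kg v wRv)
  sound (truth j g) w = imp (sat w (k j g)) (sat w g) λ kg → ⊨k⁻ g kg w (R-refl j w)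
  sound (pos-introspect j g) w = imp (sat w (k j g)) (sat w (k j (k j g))) λ kg →
    ⊨k⁺ (k j g) λ v wRv → ⊨k⁺ g λ u vRu → ⊨k⁻ g kg u (R-trans _ _ _ _ wRv vRu)
  sound (neg-introspect j g) w = imp (sat w (~ k j g)) (sat w (k j (~ k j g))) λ ¬kg →
    ⊨k⁺ (~ k j g) λ v wRv → not⁺ (sat v (k j g)) λ kg →
      not⁻ (sat w (k j g)) ¬kg (⊨k⁺ g λ u wRu → ⊨k⁻ g kg u (R-trans _ _ _ _ (R-sym _ _ _ wRv) wRu))
  sound (modus-ponens {g} {h} ⊢gh ⊢g) w = imp⁻ (sat w g) (sat w h) (sound ⊢gh w) (sound ⊢g w)
  sound (necessitation {g} j ⊢g) w = ⊨k⁺ g λ v _ → sound ⊢g v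

  private
    foldr-⊨ : ∀ {w c} Γ → All (w ⊨_) Γ → w ⊨ foldr _⇒_ c Γ → w ⊨ c
    foldr-⊨ []      []         eq = eq
    foldr-⊨ (g ∷ Γ) (⊨g ∷ ⊨Γ) eq = foldr-⊨ Γ ⊨Γ (imp⁻ _ (sat _ (foldr _⇒_ _ Γ)) eq ⊨g)

  theory : W → Ω X J
  theory w = record
    { set        = w ⊨_
    ; complete   = complete
    ; consistent = λ Γ ⊨Γ (c , ⊢) → let ⊨c , ⊨~c = and⁻ (sat w c) _ (foldr-⊨ Γ ⊨Γ (sound ⊢ w))
                                     in not⁻ (sat w c) ⊨~c ⊨c
    }
    where
    complete : Complete (w ⊨_)
    complete g with sat w g
    ... | true  = inj₁ refl
    ... | false = inj₂ refl

  R⇒≈ : ∀ j w v → R j w v → 𝒬-equiv j (theory w) (theory v)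
  R⇒≈ j w v wRv = (λ {g} kg → ⊨k⁺ g λ u vRu → ⊨k⁻ g kg u (R-trans _ _ _ _ wRv vRu))
          , (λ {g} kg → ⊨k⁺ g λ u wRu → ⊨k⁻ g kg u (R-trans _ _ _ _ (R-sym _ _ _ wRv) wRu))

  k-theory : ∀ j g w → (∀ v → R j w v → g ∈ᶠ theory v) → k j g ∈ᶠ theory w
  k-theory j g w = ⊨k⁺ g

  -- The two halves of the truth lemma at `k j g`, expressed by the labels alone. They are asked
  -- only of the subformulas to be preserved, so that a perturbed model may differ from its labels
  -- elsewhere.
  Faithful : J → Formula X J → Set _
  Faithful j g = (∀ w v → R j w v → k j g ∈ᶠ τ w → g ∈ᶠ τ v)
               × (∀ w → ¬ k j g ∈ᶠ τ w → ∃[ v ] R j w v × ¬ g ∈ᶠ τ v)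

  faithful⇒alike : ∀ g → Modally Faithful g → ∀ w → Alike (theory w) (τ w) g
  faithful⇒alike (atom x) _ w = does⇒ (atom x ∈? τ w) , dec-true (atom x ∈? τ w)
  faithful⇒alike (~ g)    m w = faithful⇒alike g m w
  faithful⇒alike (g ∧ h)  (m , m′) w = faithful⇒alike g m w , faithful⇒alike h m′ w
  faithful⇒alike (k j g)  (m , forth , back) w =
      faithful⇒alike g m w
    , known
    , λ kg∈w → ⊨k⁺ g λ v wRv → proj₂ (alike⇒agree (theory v) (τ v) g (faithful⇒alike g m v)) (forth w v wRv kg∈w)
    where
    known : w ⊨ k j g → k j g ∈ᶠ τ w
    known ⊨kg with k j g ∈? τ w
    ... | yes kg∈w = kg∈w
    ... | no  kg∉w with v , wRv , g∉v ← back w kg∉w =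
      ⊥-elim (g∉v (proj₁ (alike⇒agree (theory v) (τ v) g (faithful⇒alike g m v)) (⊨k⁻ g ⊨kg v wRv)))

-- Common knowledge

⋀-∈ : ∀ {m} (z : Ω X J) (g : Fin (suc m) → Formula X J) → (∀ i → g i ∈ᶠ z) → ⋀ g ∈ᶠ z
⋀-∈ {m = zero}  z g g∈ = g∈ fzero
⋀-∈ {m = suc m} z g g∈ = ∈-∧ z (g∈ fzero) (⋀-∈ z (g ∘ fsuc) (g∈ ∘ fsuc))

⋀-∈⁻ : ∀ {m} (z : Ω X J) (g : Fin (suc m) → Formula X J) → ⋀ g ∈ᶠ z → ∀ i → g i ∈ᶠ z
⋀-∈⁻ {m = zero}  z g g∈ fzero    = g∈
⋀-∈⁻ {m = suc m} z g g∈ fzero    = ∈-∧ˡ z g∈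
⋀-∈⁻ {m = suc m} z g g∈ (fsuc i) = ⋀-∈⁻ z (g ∘ fsuc) (∈-∧ʳ z g∈) i

Ck-≈ : ∀ {n} (f : Formula X (Fin (suc n))) {j} (z y : Ω X (Fin (suc n))) →
       Ck f z → 𝒬-equiv j z y → Ck f y
Ck-≈ f {j} z y z∈K z≈y i = ≈⇒knowledge z y z≈y (⋀-∈⁻ z (λ j → k j (E^ i f)) (z∈K (suc i)) j)

-- In a Kripke model what is true everywhere is known everywhere, so truth of `f` at all worlds
-- passes to every iterate `E^ i f`.
Ck-intro : ∀ {n} (f : Formula X (Fin (suc n))) {W : Set a} (θ : W → Ω X (Fin (suc n))) →
           (∀ j g → (∀ v → g ∈ᶠ θ v) → ∀ w → k j g ∈ᶠ θ w) →
           (∀ w → f ∈ᶠ θ w) → ∀ w → Ck f (θ w)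
Ck-intro f θ θ-k f∈ w zero    = f∈ w
Ck-intro f θ θ-k f∈ w (suc i) = ⋀-∈ (θ w) (λ j → k j (E^ i f)) λ j →
  θ-k j (E^ i f) (λ v → Ck-intro f θ θ-k f∈ v i) w

module CommonKnowledge (em : ∀ {ℓ} → ExcludedMiddle ℓ) {X : Set} {n : ℕ}
                       (e : ℕ → Formula X (Fin (suc n))) (e-onto : ∀ g → ∃[ i ] e i ≡ g)
                       (f : Formula X (Fin (suc n))) where

  open Classical em e e-onto

  private
    J′ = Fin (suc n)
    F′ = Formula X J′
    K  = Ck f

  -- The theory whose closed set of points is `K`. Validity on `K` quantifies over points and is too
  -- large for a set of formulas, hence the passage through `True` of its decision.
  common-knowledge : Theory X J′
  common-knowledge = record
    { set     = λ g → True (em {P = ∀ z → K z → g ∈ᶠ z})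
    ; theorem = λ ⊢g → fromWitness λ z _ → ∈-theorem z ⊢g
    ; detach  = λ gh g → fromWitness λ z z∈K → ∈-detach z (toWitness gh z z∈K) (toWitness g z z∈K)
    }

  ⊆Ω⇒Ck : ∀ z → common-knowledge ⊆Ω z → K z
  ⊆Ω⇒Ck z ck⊆z i = ck⊆z (fromWitness λ y y∈K → y∈K i)

  Ck⇒⊆Ω : ∀ z → K z → common-knowledge ⊆Ω z
  Ck⇒⊆Ω z z∈K g∈ = toWitness g∈ z z∈K

  Meets : F′ → Set
  Meets = Possible common-knowledge

  meets : ∀ {g} z → K z → g ∈ᶠ z → Meets g
  meets z z∈K = possible common-knowledge z (Ck⇒⊆Ω z z∈K)

  opaque
    meeting-point : ∀ {g} → Meets g → Σ[ z ∈ Ω X J′ ] K z × g ∈ᶠ z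
    meeting-point m with z , ck⊆z , g∈z ← lindenbaum common-knowledge m = z , ⊆Ω⇒Ck z ck⊆z , g∈z

  World : Set₁
  World = Σ (Ω X J′) K

  -- Perturbations of Kripke models

  module Merge (j : J′) (y y′ : Ω X J′) (y∈K : K y) (y′∈K : K y′) (alike-f : Alike y y′ f) where

    Merged : Ω X J′ → Set
    Merged x = 𝒬-equiv j x y ⊎ 𝒬-equiv j x y′

    -- The `j`-classes of `y` and `y′` are united and nothing else changes. A change of truth can
    -- therefore only originate in a formula `k j h` on which `y` and `y′` disagree.
    R : J′ → World → World → Set
    R i (x , _) (x′ , _) = 𝒬-equiv i x x′ ⊎ (i ≡ j × Merged x × Merged x′)

    merged-≈ : ∀ x x′ → 𝒬-equiv j x x′ → Merged x′ → Merged x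
    merged-≈ x x′ x≈x′ (inj₁ x′≈y)  = inj₁ (≈-trans j x x′ y x≈x′ x′≈y)
    merged-≈ x x′ x≈x′ (inj₂ x′≈y′) = inj₂ (≈-trans j x x′ y′ x≈x′ x′≈y′)

    R-sym : ∀ i w v → R i w v → R i v w
    R-sym i (w , _) (v , _) (inj₁ w≈v)            = inj₁ (≈-sym i w v w≈v)
    R-sym _ _       _       (inj₂ (i≡j , mw , mv)) = inj₂ (i≡j , mv , mw)

    R-trans : ∀ i w v u → R i w v → R i v u → R i w u
    R-trans i (w , _) (v , _) (u , _) (inj₁ w≈v) (inj₁ v≈u) = inj₁ (≈-trans i w v u w≈v v≈u)
    R-trans _ (w , _) (v , _) _ (inj₁ w≈v) (inj₂ (refl , mv , mu)) =
      inj₂ (refl , merged-≈ w v w≈v mv , mu)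
    R-trans _ _ (v , _) (u , _) (inj₂ (refl , mw , mv)) (inj₁ v≈u) =
      inj₂ (refl , mw , merged-≈ u v (≈-sym j v u v≈u) mv)
    R-trans _ _ _ _ (inj₂ (i≡j , mw , _)) (inj₂ (_ , _ , mu)) = inj₂ (i≡j , mw , mu)

    open Kripke em World proj₁ R (λ i w → inj₁ (≈-refl i (proj₁ w))) R-sym R-trans

    Mergeable : F′ → Set
    Mergeable = Modally (λ i h → i ≢ j ⊎ Agree y y′ (k i h))

    faithful : ∀ i h → i ≢ j ⊎ Agree y y′ (k i h) → Faithful i h
    faithful i h mergeable = forth mergeable , back
      where
      forth : i ≢ j ⊎ Agree y y′ (k i h) → ∀ w v → R i w v → k i h ∈ᶠ proj₁ w → h ∈ᶠ proj₁ v
      forth _ w v (inj₁ w≈v) kh∈w = ≈⇒knowledge (proj₁ w) (proj₁ v) w≈v kh∈w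
      forth (inj₁ i≢j) w v (inj₂ (i≡j , _)) kh∈w = ⊥-elim (i≢j i≡j)
      -- Knowledge of `h` is carried from `w` to `y`, then by agreement to whichever class contains
      -- `v`, where the truth axiom applies.
      forth (inj₂ (y⊆y′ , y′⊆y)) w v (inj₂ (refl , mw , mv)) kh∈w = ∈-apply (proj₁ v) (truth j h) (reach mv (leave mw))
        where
        leave : Merged (proj₁ w) → k j h ∈ᶠ y
        leave (inj₁ (w⊆y , _))  = w⊆y kh∈w
        leave (inj₂ (w⊆y′ , _)) = y′⊆y (w⊆y′ kh∈w)
        reach : Merged (proj₁ v) → k j h ∈ᶠ y → k j h ∈ᶠ proj₁ v
        reach (inj₁ (_ , y⊆v))  kh∈y = y⊆v kh∈y
        reach (inj₂ (_ , y′⊆v)) kh∈y = y′⊆v (y⊆y′ kh∈y)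
      back : ∀ w → ¬ k i h ∈ᶠ proj₁ w → ∃[ v ] R i w v × ¬ h ∈ᶠ proj₁ v
      back (x , x∈K) kh∉x with x′ , x≈x′ , h∉x′ ← unknown-witness x kh∉x =
        (x′ , Ck-≈ f x x′ x∈K x≈x′) , inj₁ x≈x′ , h∉x′

    mergeable⇒alike : ∀ g → Mergeable g → ∀ w → Alike (theory w) (proj₁ w) g
    mergeable⇒alike g m = faithful⇒alike g (modally-map _ _ faithful g m)

    alike⇒mergeable : ∀ g → Alike y y′ g → Mergeable g
    alike⇒mergeable g a = modally-map _ _ (λ _ _ → inj₂) g (alike⇒modally y y′ g a)

    theory∈K : ∀ w → K (theory w)
    theory∈K = Ck-intro f theory (λ j g g∈ w → k-theory j g w λ v _ → g∈ v) λ w →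
      proj₂ (alike⇒agree (theory w) (proj₁ w) f
        (mergeable⇒alike f (alike⇒mergeable f alike-f) w)) (proj₂ w 0)

    t t′ : Ω X J′
    t  = theory (y , y∈K)
    t′ = theory (y′ , y′∈K)

    t≈t′ : 𝒬-equiv j t t′
    t≈t′ = R⇒≈ j (y , y∈K) (y′ , y′∈K) (inj₂ (refl , inj₁ (≈-refl j y) , inj₂ (≈-refl j y′)))

  opaque
    merge : ∀ j y y′ → K y → K y′ → Alike y y′ f →
            Σ[ t ∈ Ω X J′ ] Σ[ t′ ∈ Ω X J′ ] K t × K t′ × 𝒬-equiv j t t′ ×
            (∀ g → Modally (λ i h → i ≢ j ⊎ Agree y y′ (k i h)) g → Alike t y g × Alike t′ y′ g)
    merge j y y′ y∈K y′∈K alike-f = t , t′ , theory∈K _ , theory∈K _ , t≈t′ ,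
      λ g m → mergeable⇒alike g m _ , mergeable⇒alike g m _
      where open Merge j y y′ y∈K y′∈K alike-f

  -- The second copies of the points of the b-class of y₁ form a class of their own,
  -- except those at which ψ holds, which stay in the old class. So b knows at the
  -- second copy of y₁ that ψ fails, while at y₁ itself b may consider ψ possible.
  module Prune (b j : J′) (b≢j : b ≢ j) (y₁ : Ω X J′) (y₁∈K : K y₁)
               (h u : F′) (kh∉y₁ : ¬ k j h ∈ᶠ y₁) where

    -- `ψ` holds at the points that look like `y₁` on all subformulas of `f`, `h` and `u` but at
    -- which `j` knows `h`. It fails at `y₁` itself.
    G ψ : F′
    G = (f ∧ h) ∧ u
    ψ = portrait y₁ G ∧ k j h

    τ : World × Bool → Ω X J′
    τ ((x , _) , _) = x

    Pruned : World × Bool → Set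
    Pruned (w , t) = t ≡ true × 𝒬-equiv b (proj₁ w) y₁ × ¬ ψ ∈ᶠ proj₁ w

    R : J′ → World × Bool → World × Bool → Set
    R i w v = 𝒬-equiv i (τ w) (τ v) × (i ≡ b → (Pruned w → Pruned v) × (Pruned v → Pruned w))

    R-sym : ∀ i w v → R i w v → R i v w
    R-sym i w v (w≈v , same) = ≈-sym i (τ w) (τ v) w≈v , λ i≡b → proj₂ (same i≡b) , proj₁ (same i≡b)

    R-trans : ∀ i w v u → R i w v → R i v u → R i w u
    R-trans i w v u (w≈v , same) (v≈u , same′) = ≈-trans i (τ w) (τ v) (τ u) w≈v v≈u , λ i≡b →
      proj₁ (same′ i≡b) ∘ proj₁ (same i≡b) , proj₂ (same i≡b) ∘ proj₂ (same′ i≡b)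

    open Kripke em (World × Bool) τ R (λ i w → ≈-refl i (τ w) , λ _ → id , id) R-sym R-trans

    -- Points satisfying `ψ` are alike to `y₁` on `G`, so `y₁` can replace them as counterexamples
    -- to such a `g`.
    Determined : F′ → Set₁
    Determined g = ∀ q → Alike y₁ q G → Agree y₁ q g

    faithful : ∀ i g → i ≢ b ⊎ Determined g → Faithful i g
    faithful i g cause = (λ w v (w≈v , _) → ≈⇒knowledge (τ w) (τ v) w≈v) , back cause
      where
      ψ∉y₁ : ¬ ψ ∈ᶠ y₁
      ψ∉y₁ ψ∈y₁ = kh∉y₁ (∈-∧ʳ y₁ ψ∈y₁)
      back : i ≢ b ⊎ Determined g → ∀ w → ¬ k i g ∈ᶠ τ w → ∃[ v ] R i w v × ¬ g ∈ᶠ τ v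
      back cause w@((x , x∈K) , _) kg∉x with q , x≈q , g∉q ← unknown-witness x kg∉x = choose cause
        where
        q∈K : K q
        q∈K = Ck-≈ f x q x∈K x≈q
        choose : i ≢ b ⊎ Determined g → ∃[ v ] R i w v × ¬ g ∈ᶠ τ v
        choose (inj₁ i≢b) = ((q , q∈K) , false) , (x≈q , λ i≡b → ⊥-elim (i≢b i≡b)) , g∉q
        choose (inj₂ determined) with i ≟ b | em {P = Pruned w} | ψ ∈? q
        ... | no i≢b | _ | _ = ((q , q∈K) , false) , (x≈q , λ i≡b → ⊥-elim (i≢b i≡b)) , g∉q
        ... | yes refl | no ¬pruned | _ = ((q , q∈K) , false)
              , (x≈q , λ _ → (λ pruned → ⊥-elim (¬pruned pruned)) , λ { (() , _) }) , g∉q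
        ... | yes refl | yes pruned@(_ , x≈y₁ , _) | no ψ∉q = ((q , q∈K) , true)
              , (x≈q , λ _ → (λ _ → refl , ≈-trans b q x y₁ (≈-sym b x q x≈q) x≈y₁ , ψ∉q) , λ _ → pruned) , g∉q
        -- The counterexample `q` is excluded from the new class by `ψ`. The second copy of `y₁`,
        -- which lies in that class, takes its place.
        ... | yes refl | yes pruned@(_ , x≈y₁ , _) | yes ψ∈q = ((y₁ , y₁∈K) , true)
              , (x≈y₁ , λ _ → (λ _ → refl , ≈-refl b y₁ , ψ∉y₁) , λ _ → pruned)
              , λ g∈y₁ → g∉q (proj₁ (determined q (portrait⇒alike y₁ q G (∈-∧ˡ q ψ∈q))) g∈y₁)

    determined : ∀ g → (∀ q → Alike y₁ q G → Alike y₁ q g) → Modally (λ i g → i ≢ b ⊎ Determined g) g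
    determined (atom x) _ = tt
    determined (~ g)    d = determined g d
    determined (g ∧ h)  d = determined g (λ q a → proj₁ (d q a)) , determined h (λ q a → proj₂ (d q a))
    determined (k i g)  d = determined g (λ q a → proj₁ (d q a))
                          , inj₂ λ q a → alike⇒agree y₁ q g (proj₁ (d q a))

    alike : ∀ w → Alike (theory w) (τ w) (G ∧ k j h)
    alike = faithful⇒alike (G ∧ k j h) (modally-map _ _ faithful (G ∧ k j h)
      ( determined G (λ q a → a)
      -- `h` occurs in `G`, and `k j h` is safe because only a class of `b` was cut.
      , determined h (λ q a → proj₂ (proj₁ a)) , inj₁ (λ j≡b → b≢j (sym j≡b))))

    alike-ψ : ∀ w → Alike (theory w) (τ w) ψ
    alike-ψ w = portrait-alike y₁ G (proj₁ (alike w)) , proj₂ (alike w)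

    theory∈K : ∀ w → K (theory w)
    theory∈K = Ck-intro f theory (λ j g g∈ w → k-theory j g w λ v _ → g∈ v) λ w →
      proj₂ (alike⇒agree (theory w) (τ w) f (proj₁ (proj₁ (proj₁ (alike w))))) (proj₂ (proj₁ w) 0)

    root : World × Bool
    root = (y₁ , y₁∈K) , true

    known : k b (~ ψ) ∈ᶠ theory root
    known = k-theory b (~ ψ) root λ v (_ , same) → ∈-~ {g = ψ} (theory v) λ ψ∈θ →
      proj₂ (proj₂ (proj₁ (same refl) (refl , ≈-refl b y₁ , λ ψ∈y₁ → kh∉y₁ (∈-∧ʳ y₁ ψ∈y₁))))
        (proj₁ (alike⇒agree (theory v) (τ v) ψ (alike-ψ v)) ψ∈θ)

  opaque
    -- The new point is the second copy of `y₁`, where `b` knows `~ ψ`. At `y₁` this is not known,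
    -- as `ψ` holds at `y₂` in the same `b`-class. A disagreement about what `j` knows thus becomes
    -- one about what `b` knows.
    prune : ∀ b j → b ≢ j → ∀ y₁ y₂ → K y₁ → 𝒬-equiv b y₁ y₂ → ∀ h u →
            Alike y₁ y₂ ((f ∧ h) ∧ u) → ¬ k j h ∈ᶠ y₁ → k j h ∈ᶠ y₂ →
            Σ[ y₃ ∈ Ω X J′ ] K y₃ × Alike y₃ y₁ ((f ∧ h) ∧ u) ×
            ∃[ c ] Alike y₃ y₁ c × ¬ Agree y₃ y₁ (k b c)
    prune b j b≢j y₁ y₂ y₁∈K y₁≈y₂ h u alike₁₂ kh∉y₁ kh∈y₂ =
      theory root , theory∈K root , proj₁ (alike root) , ~ ψ , alike-ψ root , λ agree →
        ∉-~ y₂ (≈⇒knowledge y₁ y₂ y₁≈y₂ (proj₁ agree known))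
          (∈-∧ y₂ (proj₁ (alike⇒agree y₁ y₂ (portrait y₁ G) (portrait-alike y₁ G alike₁₂)) (portrait-∈ y₁ G)) kh∈y₂)
      where
      open Prune b j b≢j y₁ y₁∈K h u kh∉y₁
      open Kripke em (World × Bool) τ R (λ i w → ≈-refl i (τ w) , λ _ → id , id) R-sym R-trans using (theory)

  -- Distinct points in one possibility set

  data Difference (z y : Ω X J′) : Set where
    atomic : ∀ {x} → ¬ Agree z y (atom x) → Difference z y
    modal  : ∀ {j} h → Alike z y h → ¬ Agree z y (k j h) → Difference z y

  -- The search returns an innermost disagreement, so that in the case `modal` the points agree on
  -- everything inside `h`.
  first-difference : ∀ z y g → Alike z y g ⊎ Difference z y
  first-difference z y (atom x) with em {P = Agree z y (atom x)}
  ... | yes agree = inj₁ agree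
  ... | no ¬agree = inj₂ (atomic ¬agree)
  first-difference z y (~ g) = first-difference z y g
  first-difference z y (g ∧ h) with first-difference z y g | first-difference z y h
  ... | inj₁ a | inj₁ b = inj₁ (a , b)
  ... | inj₂ d | _      = inj₂ d
  ... | inj₁ _ | inj₂ d = inj₂ d
  first-difference z y (k j g) with first-difference z y g | em {P = Agree z y (k j g)}
  ... | inj₁ a | yes agree = inj₁ (a , agree)
  ... | inj₁ a | no ¬agree = inj₂ (modal g a ¬agree)
  ... | inj₂ d | _         = inj₂ d

  disagree : ∀ (z y : Ω X J′) g → ¬ Agree z y g → (g ∈ᶠ z × ¬ g ∈ᶠ y) ⊎ (¬ g ∈ᶠ z × g ∈ᶠ y)
  disagree z y g ¬agree with g ∈? z | g ∈? y
  ... | yes g∈z | yes g∈y = ⊥-elim (¬agree ((λ _ → g∈y) , (λ _ → g∈z)))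
  ... | yes g∈z | no g∉y  = inj₁ (g∈z , g∉y)
  ... | no g∉z  | yes g∈y = inj₂ (g∉z , g∈y)
  ... | no g∉z  | no g∉y  = ⊥-elim (¬agree ((λ g∈z → ⊥-elim (g∉z g∈z)) , (λ g∈y → ⊥-elim (g∉y g∈y))))

  module Twins (another : ∀ (j : J′) → ∃[ b ] b ≢ j)
               (perfect : ∀ {g} → Meets g → Σ[ z ∈ Ω X J′ ] Σ[ y ∈ Ω X J′ ]
                  K z × K y × g ∈ᶠ z × g ∈ᶠ y × ∃[ s ] ¬ Agree z y s) where

    Twins : J′ → F′ → Set₁
    Twins j u = Σ[ z ∈ Ω X J′ ] Σ[ y ∈ Ω X J′ ]
      K z × 𝒬-equiv j z y × u ∈ᶠ z × u ∈ᶠ y × ∃[ s ] ¬ Agree z y s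

    -- Uniting the `j`-classes makes the two points equivalent, and the disagreement on `s` survives
    -- if no knowledge subformula of `s` is disturbed.
    join : ∀ j u z y → K z → K y → Alike z y (f ∧ u) → u ∈ᶠ z → ∀ s → ¬ Agree z y s →
           Modally (λ i h → i ≢ j ⊎ Agree z y (k i h)) s → Twins j u
    join j u z y z∈K y∈K (alike-f , alike-u) u∈z s ¬agree m
      with t , t′ , t∈K , _ , t≈t′ , keeps ← merge j z y z∈K y∈K alike-f =
        t , t′ , t∈K , t≈t′
      , proj₂ (alike⇒agree t z u (proj₁ keeps-u)) u∈z
      , proj₂ (alike⇒agree t′ y u (proj₂ keeps-u)) (proj₁ (alike⇒agree z y u alike-u) u∈z)
      , s , λ agree → ¬agree (agree-trans z t y s (agree-sym t z s (alike⇒agree t z s (proj₁ (keeps s m))))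
                               (agree-trans t t′ y s agree (alike⇒agree t′ y s (proj₂ (keeps s m)))))
      where
      keeps-u : Alike t z u × Alike t′ y u
      keeps-u = keeps u (modally-map _ _ (λ _ _ → inj₂) u (alike⇒modally z y u alike-u))

    separate : ∀ j u z y → K z → K y → Alike z y (f ∧ u) → u ∈ᶠ z → Difference z y → Twins j u
    separate j u z y z∈K y∈K alike u∈z (atomic {x} ¬agree) =
      join j u z y z∈K y∈K alike u∈z (atom x) ¬agree tt
    separate j u z y z∈K y∈K alike u∈z (modal {i} h alike-h ¬agree) with i ≟ j
    ... | no i≢j = join j u z y z∈K y∈K alike u∈z (k i h) ¬agree
                     (modally-map _ _ (λ _ _ → inj₂) h (alike⇒modally z y h alike-h) , inj₁ i≢j)
    -- Uniting the `j`-classes could erase the disagreement on `k j h`. Uniting classes of another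
    -- agent `b` keeps it, and `prune` turns it into a disagreement on some `k b c`, to which `join`
    -- applies for `j`.
    ... | yes refl
      with b , b≢j ← another j
      with t , t′ , t∈K , t′∈K , t≈t′ , keeps ← merge b z y z∈K y∈K (proj₁ alike) = result
      where
      G : F′
      G = (f ∧ h) ∧ u
      alike-G : Alike z y G
      alike-G = (proj₁ alike , alike-h) , proj₂ alike
      keeps-G : Alike t z G × Alike t′ y G
      keeps-G = keeps G (modally-map _ _ (λ _ _ → inj₂) G (alike⇒modally z y G alike-G))
      keeps-kh : Alike t z (k j h) × Alike t′ y (k j h)
      keeps-kh = keeps (k j h) ( modally-map _ _ (λ _ _ → inj₂) h (alike⇒modally z y h alike-h)
                               , inj₁ λ j≡b → b≢j (sym j≡b))
      alike-tt′ : Alike t t′ G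
      alike-tt′ = alike-trans G (proj₁ keeps-G) (alike-trans G alike-G (alike-sym G (proj₂ keeps-G)))
      u∈t : u ∈ᶠ t
      u∈t = proj₂ (alike⇒agree t z u (proj₂ (proj₁ keeps-G))) u∈z
      ¬agree-tt′ : ¬ Agree t t′ (k j h)
      ¬agree-tt′ agree = ¬agree
        (agree-trans z t y (k j h) (agree-sym t z (k j h) (proj₂ (proj₁ keeps-kh)))
          (agree-trans t t′ y (k j h) agree (proj₂ (proj₂ keeps-kh))))
      pruned : ∀ y₁ y₂ → K y₁ → 𝒬-equiv b y₁ y₂ → Alike y₁ y₂ G → u ∈ᶠ y₁ →
               ¬ k j h ∈ᶠ y₁ → k j h ∈ᶠ y₂ → Twins j u
      pruned y₁ y₂ y₁∈K y₁≈y₂ alike₁₂ u∈y₁ kh∉y₁ kh∈y₂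
        with y₃ , y₃∈K , alike-G₃ , c , alike-c , ¬agree₃ ← prune b j b≢j y₁ y₂ y₁∈K y₁≈y₂ h u alike₁₂ kh∉y₁ kh∈y₂ =
          join j u y₃ y₁ y₃∈K y₁∈K (proj₁ (proj₁ alike-G₃) , proj₂ alike-G₃)
            (proj₂ (alike⇒agree y₃ y₁ u (proj₂ alike-G₃)) u∈y₁) (k b c) ¬agree₃
            (modally-map _ _ (λ _ _ → inj₂) c (alike⇒modally y₃ y₁ c alike-c) , inj₁ b≢j)
      result : Twins j u
      result with disagree t t′ (k j h) ¬agree-tt′
      ... | inj₁ (kh∈t , kh∉t′) = pruned t′ t t′∈K (≈-sym b t t′ t≈t′) (alike-sym G alike-tt′)
                                    (proj₁ (alike⇒agree t t′ u (proj₂ alike-tt′)) u∈t) kh∉t′ kh∈t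
      ... | inj₂ (kh∉t , kh∈t′) = pruned t t′ t∈K t≈t′ alike-tt′ u∈t kh∉t kh∈t′

    opaque
      -- `perfect` is applied to the portrait of a point, so that the two points obtained agree on
      -- all subformulas of `f` and `u`, as merging demands.
      twins : ∀ j {u} → Meets u → Twins j u
      twins j {u} meets-u
        with x , x∈K , u∈x ← meeting-point meets-u
        with z , y , z∈K , y∈K , χ∈z , χ∈y , s , ¬agree ← perfect (meets x x∈K (portrait-∈ x (f ∧ u)))
        with first-difference z y s
      ... | inj₁ a = ⊥-elim (¬agree (alike⇒agree z y s a))
      ... | inj₂ d = separate j u z y z∈K y∈K
                       (alike-trans (f ∧ u) (alike-sym (f ∧ u) alike-xz) (portrait⇒alike x y (f ∧ u) χ∈y))
                       (proj₁ (alike⇒agree x z u (proj₂ alike-xz)) u∈x) d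
        where
        alike-xz : Alike x z (f ∧ u)
        alike-xz = portrait⇒alike x z (f ∧ u) χ∈z

-- Cells

-- The word is recorded because the points reachable along a fixed word form a closed set. The empty
-- word ends with an inclusion, which between points amounts to equality.
data Reach {X J : Set} : List J → Ω X J → Ω X J → Set₁ where
  stop : ∀ {x y} → (∀ {g} → g ∈ᶠ x → g ∈ᶠ y) → Reach [] x y
  step : ∀ {j w x z y} → 𝒬-equiv j x z → Reach w z y → Reach (j ∷ w) x y

Cell : Ω X J → Subset {X} {J}
Cell x y = ∃[ w ] Reach w x y

□ : List J → Formula X J → Formula X J
□ []      g = g
□ (j ∷ w) g = k j (□ w g)

module _ {X J : Set} where

  private
    Pt = Ω X J

  reach-refl : (x : Pt) → Reach [] x x
  reach-refl x = stop id

  reach-step : ∀ {j} (x y : Pt) → 𝒬-equiv j x y → Reach (j ∷ []) x y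
  reach-step x y x≈y = step x≈y (reach-refl y)

  □-reach : ∀ {w g} {x y : Pt} → □ w g ∈ᶠ x → Reach w x y → g ∈ᶠ y
  □-reach g∈x (stop x⊆y) = x⊆y g∈x
  □-reach kg∈x (step {x = x} {z} x≈z r) = □-reach (≈⇒knowledge x z x≈z kg∈x) r

  reach-⊆ : ∀ {w} {x z y : Pt} → (∀ {g} → g ∈ᶠ x → g ∈ᶠ z) → Reach w z y → Reach w x y
  reach-⊆ x⊆z (stop z⊆y) = stop (λ g∈x → z⊆y (x⊆z g∈x))
  reach-⊆ {x = x} {z} x⊆z (step {j} {z = v} z≈v r) = step {z = v} (≈-trans j x z v (x⊆z , ∉-⊆ {z = x} {z} x⊆z) z≈v) r

  reach-trans : ∀ {w v} {x z y : Pt} → Reach w x z → Reach v z y → Reach (w ++ v) x y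
  reach-trans (stop x⊆z)     r′ = reach-⊆ x⊆z r′
  reach-trans (step x≈z r) r′ = step x≈z (reach-trans r r′)

  reach-sym : ∀ {w} {x y : Pt} → Reach w x y → ∃[ v ] Reach v y x
  reach-sym {x = x} {y} (stop x⊆y) = [] , stop (∉-⊆ {z = x} {y} x⊆y)
  reach-sym (step {j} {x = x} {z} x≈z r) with v , r′ ← reach-sym r =
    v ++ j ∷ [] , reach-trans r′ (reach-step z x (≈-sym j x z x≈z))

  saturated-≈ : ∀ {S : Subset} → Saturated S → ∀ {j} (x y : Pt) → S x → 𝒬-equiv j x y → S y
  saturated-≈ saturated {j} x y x∈S x≈y =
    saturated j (λ z → Lift (lsuc 0ℓ) (𝒬-equiv j x z)) (x , lower , lift)
      (x , lift (≈-refl j x) , x∈S) (lift x≈y)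

  -- The agent serves the empty word: a subset need not respect equality of points, but a saturated
  -- one does as soon as there is an agent.
  saturated-reach : ∀ {S : Subset} → J → Saturated S → ∀ {w} {x y : Pt} → S x → Reach w x y → S y
  saturated-reach j saturated {x = x} {y} x∈S (stop x⊆y) =
    saturated-≈ saturated {j} x y x∈S (x⊆y , ∉-⊆ {z = x} {y} x⊆y)
  saturated-reach j saturated x∈S (step {x = x} {z} x≈z r) =
    saturated-reach j saturated (saturated-≈ saturated x z x∈S x≈z) r

  cell-saturated : (x : Pt) → Saturated (Cell x)
  cell-saturated x j P (c , P⊆ , ⊆P) (z , z∈P , w , r) {y} y∈P =
    w ++ j ∷ [] , reach-trans r (reach-step z y (≈-trans j z c y (≈-sym j c z (P⊆ z∈P)) (P⊆ y∈P)))

  cell-isCell : J → (x : Pt) → IsCell (Cell x)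
  cell-isCell j x = (x , [] , reach-refl x) , cell-saturated x
    , λ D (y , y∈D) saturated D⊆ (_ , r) →
        saturated-reach j saturated (saturated-reach j saturated y∈D (proj₂ (reach-sym (proj₂ (D⊆ y∈D))))) r

  isCell-reach : J → ∀ {C : Subset} {x : Pt} → IsCell C → C x → C ≐ Cell x
  isCell-reach j {x = x} (_ , saturated , minimal) x∈C =
      minimal (Cell x) (x , [] , reach-refl x) (cell-saturated x) Cell⊆C , Cell⊆C
    where
    Cell⊆C : Cell x ⊆ _
    Cell⊆C (w , r) = saturated-reach j saturated x∈C r

  opaque
    isCell⇒reach : J → ∀ {C : Subset} {x y : Pt} → IsCell C → C x → C y → ∃[ w ] Reach w x y
    isCell⇒reach j cell x∈C y∈C = proj₁ (isCell-reach j cell x∈C) y∈C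

-- Closedness of reachability along a word

module Reachability (em : ∀ {ℓ} → ExcludedMiddle ℓ) {X J : Set}
                    (e : ℕ → Formula X J) (e-onto : ∀ g → ∃[ i ] e i ≡ g) where

  open Classical em e e-onto

  □-mono : ∀ w {g h} (z : Ω X J) → (∀ y → g ∈ᶠ y → h ∈ᶠ y) → □ w g ∈ᶠ z → □ w h ∈ᶠ z
  □-mono []      z g⊆h = g⊆h z
  □-mono (j ∷ w) z g⊆h = k-mono z λ y → □-mono w y g⊆h

  opaque
    reachable : ∀ w {g} (x : Ω X J) → ¬ □ w (~ g) ∈ᶠ x → Σ[ y ∈ Ω X J ] Reach w x y × g ∈ᶠ y
    reachable [] {g} x ~g∉x = x , reach-refl x , ∈-apply x (double-negation g) (∈-~ x ~g∉x)
    reachable (j ∷ w) x ∉x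
      with z , x≈z , ∉z ← unknown-witness x ∉x
      with y , r , g∈y ← reachable w z ∉z = y , step x≈z r , g∈y

  module _ (j : J) (w : List J) (x y : Ω X J) where

    -- The points containing this theory are those `j`-equivalent to `x` from which, for each `g` in
    -- `y`, some point with `g` is reachable along `w`. Two such `g` combine into their conjunction,
    -- again in `y`.
    between : Theory X J
    between = record
      { set     = λ φ → ∃[ g ] g ∈ᶠ y × k j (~ □ w (~ g) ⇒ φ) ∈ᶠ x
      ; theorem = λ {φ} ⊢φ → φ , ∈-theorem y ⊢φ
                  , ∈-theorem x (necessitation j (modus-ponens (weakening _ _) ⊢φ))
      ; detach  = λ {φ} {ψ} (g , g∈y , kg) (h , h∈y , kh) → g ∧ h , ∈-∧ y g∈y h∈y
                  , k-mono {h = ~ □ w (~ (g ∧ h)) ⇒ ψ} x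
                      (λ v both → ∈-⇒ v λ ◇gh →
                        ∈-detach v (∈-detach v (∈-∧ˡ v both) (◇-mono v (λ u → ∈-∧ˡ u) ◇gh))
                                   (∈-detach v (∈-∧ʳ v both) (◇-mono v (λ u → ∈-∧ʳ u) ◇gh)))
                      (Theory.detach Kx (Theory.detach Kx (Theory.theorem Kx (pairing _ _)) kg) kh)
      }
      where
      Kx = theory-of-knowledge j x
      ◇-mono : ∀ {g h} v → (∀ u → g ∈ᶠ u → h ∈ᶠ u) → ~ □ w (~ g) ∈ᶠ v → ~ □ w (~ h) ∈ᶠ v
      ◇-mono v g⊆h ◇g = ∈-~ v λ □~h → ∉-~ v ◇g
        (□-mono w v (λ u ~h∈u → ∈-~ u λ g∈u → ∉-~ u ~h∈u (g⊆h u g∈u)) □~h)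

  opaque
    -- By compactness: were `between` contradictory, `j` would know at `x` that no point with a
    -- certain `g` of `y` is reachable along `w`, against the hypothesis. A point containing
    -- `between` is the next one on the way to `y`.
    reach-closed : ∀ w (x y : Ω X J) → (∀ g → g ∈ᶠ y → ¬ □ w (~ g) ∈ᶠ x) → Reach w x y
    reach-closed [] x y compatible = stop (∉-⊆ {z = y} {x} λ {g} g∈y →
      ∈-apply x (double-negation g) (∈-~ x (compatible g g∈y)))
    reach-closed (j ∷ w) x y compatible
      -- `e 0 ⇒ e 0` stands for a theorem and makes no demand on the point.
      with z , T⊆z , _ ← lindenbaum (between j w x y) {e 0 ⇒ e 0}
           (λ (g , g∈y , kg∈x) → compatible g g∈y (k-mono x (λ v imp →
              ∈-apply v (double-negation _) (∈-~ v λ ◇g∈v →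
                ∉-~ v (∈-detach v imp ◇g∈v) (∈-theorem v (identity _)))) kg∈x)) =
      step (knowledge⇒≈ x z λ {g} kg∈x → T⊆z (e 0 ⇒ e 0 , ∈-theorem y (identity _)
             , k-mono x (λ v g∈v → ∈-apply v (weakening _ _) g∈v) kg∈x))
           (reach-closed w z y λ g g∈y → ∉-~ z (T⊆z (g , g∈y , ∈-theorem x (necessitation j (identity _)))))

-- Generic points

module DenseCells (em : ∀ {ℓ} → ExcludedMiddle ℓ) {X : Set} {n : ℕ}
                  (e : ℕ → Formula X (Fin (suc n))) (e-onto : ∀ g → ∃[ i ] e i ≡ g)
                  (f : Formula X (Fin (suc n)))
                  (another : ∀ (j : Fin (suc n)) → ∃[ b ] b ≢ j)
                  (C C′ : Subset) (dense-C : IsDenseCell f C) (dense-C′ : IsDenseCell f C′)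
                  (C≢C′ : ¬ C ≐ C′) where

  open Classical em e e-onto
  open CommonKnowledge em e e-onto f
  open Reachability em e e-onto

  private
    J′ = Fin (suc n)
    F′ = Formula X J′
    Pt = Ω X J′
    K  = Ck f

  opaque
    dense-hits : ∀ {D g} → IsDenseCell f D → Meets g → Σ[ y ∈ Pt ] D y × K y × g ∈ᶠ y
    dense-hits {g = g} (_ , _ , dense) meets-g
      with z , z∈K , g∈z ← meeting-point meets-g
      with y , (g∈y , y∈K) , y∈D ← dense (λ z → Lift _ (g ∈ᶠ z)) (λ g∈z → g , lower g∈z , lift)
                                          (z , lift g∈z , z∈K) =
      y , y∈D , y∈K , lower g∈y

  unreachable : ∀ {w} (x y : Pt) → C x → C′ y → ¬ Reach w x y
  unreachable x y x∈C y∈C′ r =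
    C≢C′ ( (λ z∈C → proj₂ C′≐ (proj₁ C≐ z∈C)) , (λ z∈C′ → proj₂ C≐ (proj₁ C′≐ z∈C′)))
    where
    C≐  : C ≐ Cell x
    C≐  = isCell-reach fzero (proj₁ dense-C) x∈C
    C′≐ : C′ ≐ Cell x
    C′≐ = isCell-reach fzero (proj₁ dense-C′)
            (saturated-reach fzero (proj₁ (proj₂ (proj₁ dense-C′))) y∈C′ (proj₂ (reach-sym r)))

  opaque
    -- The points are taken from the two different dense cells; a path between them would identify
    -- the cells.
    separated-points : ∀ {g h} → Meets g → Meets h →
      Σ[ x ∈ Pt ] Σ[ y ∈ Pt ] K x × K y × g ∈ᶠ x × h ∈ᶠ y × (∀ w → ¬ Reach w x y)
    separated-points meets-g meets-h
      with x , x∈C , x∈K , g∈x ← dense-hits dense-C meets-g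
      with y , y∈C′ , y∈K , h∈y ← dense-hits dense-C′ meets-h =
      x , y , x∈K , y∈K , g∈x , h∈y , λ _ → unreachable x y x∈C y∈C′

  opaque
    perfect : ∀ {g} → Meets g → Σ[ z ∈ Pt ] Σ[ y ∈ Pt ]
                K z × K y × g ∈ᶠ z × g ∈ᶠ y × ∃[ s ] ¬ Agree z y s
    perfect meets-g with x , y , x∈K , y∈K , g∈x , g∈y , far ← separated-points meets-g meets-g
      with em {P = ∃[ s ] ¬ Agree x y s}
    ... | yes s = x , y , x∈K , y∈K , g∈x , g∈y , s
    ... | no alike = ⊥-elim (far [] (stop λ {s} → proj₁ (decidable-stable em λ ¬agree → alike (s , ¬agree))))

  open Twins another perfect

  opaque
    -- As reachability along `w` is closed, its failure from `x` to `y` is witnessed by some `s` in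
    -- `y` with `□ w (~ s)` in `x`. These two formulas shrink the given basic sets.
    separating : ∀ w {g h} → Meets g → Meets h →
      ∃[ x ] ∃[ y ] Meets (g ∧ x) × Meets (h ∧ y) × (∀ z → x ∈ᶠ z → □ w (~ y) ∈ᶠ z)
    separating w meets-g meets-h
      with x , y , x∈K , y∈K , g∈x , h∈y , far ← separated-points meets-g meets-h
      with em {P = ∃[ s ] s ∈ᶠ y × □ w (~ s) ∈ᶠ x}
    ... | yes (s , s∈y , □~s∈x) = □ w (~ s) , s
          , meets x x∈K (∈-∧ x g∈x □~s∈x) , meets y y∈K (∈-∧ y h∈y s∈y) , λ _ → id
    ... | no compatible = ⊥-elim (far w (reach-closed w x y λ s s∈y □~s∈x → compatible (s , s∈y , □~s∈x)))

  opaque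
    -- Points of different cells are never `j`-equivalent, so they disagree about what `j` knows.
    splitting-knowledge : ∀ j {g} → Meets g → ∃[ c ] Meets (g ∧ k j c) × Meets (g ∧ ~ k j c)
    splitting-knowledge j meets-g with x , y , x∈K , y∈K , g∈x , g∈y , far ← separated-points meets-g meets-g
      with em {P = ∃[ c ] ¬ Agree x y (k j c)}
    ... | no alike = ⊥-elim (far (j ∷ []) (reach-step x y
            ( (λ {c} → proj₁ (decidable-stable em λ ¬agree → alike (c , ¬agree)))
            , (λ {c} → proj₂ (decidable-stable em λ ¬agree → alike (c , ¬agree))))))
    ... | yes (c , ¬agree) with disagree x y (k j c) ¬agree
    ... | inj₁ (kc∈x , kc∉y) = c , meets x x∈K (∈-∧ x g∈x kc∈x) , meets y y∈K (∈-∧ y g∈y (∈-~ y kc∉y))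
    ... | inj₂ (kc∉x , kc∈y) = c , meets y y∈K (∈-∧ y g∈y kc∈y) , meets x x∈K (∈-∧ x g∈x (∈-~ x kc∉x))

  -- Codes for the dense open subsets of K that a generic point has to meet.
  -- The subsets coded by `within` express that the generic points are dense in
  -- every possibility set of a generic point.
  data Code : Set where
    splits : J′ → F′ → Code
    visits : F′ → Code
    within : J′ → F′ → Code → Code

  -- Obeying all `splits` means that the possibility sets of the point have no isolated points, and
  -- obeying all `visits` that its cell meets every open set meeting `K`. `Forces` compares a basic
  -- set within `K` with the coded set.
  Obeys  : Code → Pt → Set₁
  Forces : Code → F′ → Set₁

  Obeys (splits j u) z =
    Lift _ (k j (~ u) ∈ᶠ z ⊎ ∃[ s ] ◇ j (u ∧ s) ∈ᶠ z × ◇ j (u ∧ ~ s) ∈ᶠ z)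
  Obeys (visits u) z = Lift _ (Meets u → ∃[ w ] ¬ □ w (~ u) ∈ᶠ z)
  Obeys (within j u c) z = k j (~ u) ∈ᶠ z ⊎ ∃[ s ] Forces c (u ∧ s) × ◇ j (u ∧ s) ∈ᶠ z

  Forces c g = ∀ z → K z → g ∈ᶠ z → Obeys c z

  opaque
    ◇-unless : ∀ {j u} (z : Pt) → ¬ k j (~ u) ∈ᶠ z → Σ[ y ∈ Pt ] 𝒬-equiv j z y × u ∈ᶠ y
    ◇-unless z k∉z = ◇-witness z (∈-~ z k∉z)

  -- For `splits` and `within`, either `k j (~ u)` is compatible with `h`, or a point of `h` has a
  -- `j`-neighbour in `u`. The construction then takes place near that neighbour, and keeping
  -- `◇ j h` true there leads back to a point of `h`. For `visits`, one dense cell meets both `h`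
  -- and `u`.
  forcing-dense : ∀ c {h} → Meets h → ∃[ x ] Meets (h ∧ x) × Forces c (h ∧ x)
  forcing-dense (splits j u) {h} meets-h with em {P = Meets (h ∧ k j (~ u))}
  ... | yes m = k j (~ u) , m , λ z _ g∈z → lift (inj₁ (∈-∧ʳ z g∈z))
  ... | no ¬m
    with x , x∈K , h∈x ← meeting-point meets-h
    with y , x≈y , u∈y ← ◇-unless {j} {u} x (λ k∈x → ¬m (meets x x∈K (∈-∧ x h∈x k∈x)))
    with p , q , p∈K , p≈q , p∈ , q∈ , s , ¬agree ← twins j (meets y (Ck-≈ f x y x∈K x≈y)
           (∈-∧ y u∈y (∈-◇ y x (≈-sym j x y x≈y) h∈x)))
    with o , p≈o , h∈o ← ◇-witness p (∈-∧ʳ p p∈) = result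
    where
    Split = λ s → ◇ j (u ∧ s) ∧ ◇ j (u ∧ ~ s)
    o≈p : 𝒬-equiv j o p
    o≈p = ≈-sym j p o p≈o
    split : Split s ∈ᶠ o
    split with disagree p q s ¬agree
    ... | inj₁ (s∈p , s∉q) = ∈-∧ o (∈-◇ o p o≈p (∈-∧ p (∈-∧ˡ p p∈) s∈p))
                                   (∈-◇ o q (≈-trans j o p q o≈p p≈q) (∈-∧ q (∈-∧ˡ q q∈) (∈-~ q s∉q)))
    ... | inj₂ (s∉p , s∈q) = ∈-∧ o (∈-◇ o q (≈-trans j o p q o≈p p≈q) (∈-∧ q (∈-∧ˡ q q∈) s∈q))
                                   (∈-◇ o p o≈p (∈-∧ p (∈-∧ˡ p p∈) (∈-~ p s∉p)))
    result : ∃[ x ] Meets (h ∧ x) × Forces (splits j u) (h ∧ x)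
    result = Split s , meets o (Ck-≈ f p o p∈K p≈o) (∈-∧ o h∈o split)
           , λ z _ g∈z → lift (inj₂ (s , ∈-∧ˡ z (∈-∧ʳ z g∈z) , ∈-∧ʳ z (∈-∧ʳ z g∈z)))
  forcing-dense (visits u) {h} meets-h with em {P = Meets u}
  ... | no ¬m
    with x , x∈K , h∈x ← meeting-point meets-h =
      h , meets x x∈K (∈-∧ x h∈x h∈x) , λ _ _ _ → lift (λ m → ⊥-elim (¬m m))
  ... | yes m
    with x , x∈C , x∈K , h∈x ← dense-hits dense-C meets-h
    with y , y∈C , y∈K , u∈y ← dense-hits dense-C m
    with w , r ← isCell⇒reach fzero (proj₁ dense-C) x∈C y∈C =
      ~ □ w (~ u) , meets x x∈K (∈-∧ x h∈x (∈-~ x λ □~u∈x → ∉-~ y (□-reach □~u∈x r) u∈y))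
      , λ z _ g∈z → lift (λ _ → w , ∉-~ z (∈-∧ʳ z g∈z))
  forcing-dense (within j u c) {h} meets-h with em {P = Meets (h ∧ k j (~ u))}
  ... | yes m = k j (~ u) , m , λ z _ g∈z → inj₁ (∈-∧ʳ z g∈z)
  ... | no ¬m
    with x , x∈K , h∈x ← meeting-point meets-h
    with y , x≈y , u∈y ← ◇-unless {j} {u} x (λ k∈x → ¬m (meets x x∈K (∈-∧ x h∈x k∈x)))
    with v , meets-v , forces ← forcing-dense c (meets y (Ck-≈ f x y x∈K x≈y)
           (∈-∧ y u∈y (∈-◇ y x (≈-sym j x y x≈y) h∈x)))
    with p , p∈K , p∈ ← meeting-point meets-v
    with o , p≈o , h∈o ← ◇-witness p (∈-∧ʳ p (∈-∧ˡ p p∈)) =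
      ◇ j (u ∧ (◇ j h ∧ v)) , meets o (Ck-≈ f p o p∈K p≈o) (∈-∧ o h∈o
        (∈-◇ o p (≈-sym j p o p≈o) (∈-∧ p (∈-∧ˡ p (∈-∧ˡ p p∈)) (∈-∧ p (∈-∧ʳ p (∈-∧ˡ p p∈)) (∈-∧ʳ p p∈)))))
      -- `◇ j h` enters the formula because `forces` speaks of the conjunction of `u`, `◇ j h` and
      -- `v`.
      , λ z _ g∈z → inj₂ (◇ j h ∧ v
                         , (λ q q∈K q∈ → forces q q∈K (∈-∧ q (∈-∧ q (∈-∧ˡ q q∈) (∈-∧ˡ q (∈-∧ʳ q q∈))) (∈-∧ʳ q (∈-∧ʳ q q∈))))
                         , ∈-∧ʳ z g∈z)

  -- Codes are counted by an injection into the formulas, which `e` enumerates.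
  encode : Code → F′
  encode (splits j u)   = k j u
  encode (visits u)     = ~ u
  encode (within j u c) = k j u ∧ encode c

  encode-injective : ∀ c d → encode c ≡ encode d → c ≡ d
  encode-injective (splits _ _)   (splits _ _)   refl = refl
  encode-injective (visits _)     (visits _)     refl = refl
  encode-injective (within _ _ c) (within _ _ d) eq with encode c in eq₁ | encode d in eq₂
  encode-injective (within _ _ c) (within _ _ d) refl | _ | _ =
    cong (within _ _) (encode-injective c d (trans eq₁ (sym eq₂)))

  code : ℕ → Code
  code m with em {P = ∃[ c ] encode c ≡ e m}
  ... | yes (c , _) = c
  -- Formulas that encode nothing get an arbitrary code.
  ... | no _        = visits (e 0)

  code-onto : ∀ c → ∃[ m ] code m ≡ c
  code-onto c with m , em≡ ← e-onto (encode c) = m , eq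
    where
    eq : code m ≡ c
    eq with em {P = ∃[ d ] encode d ≡ e m}
    ... | yes (d , d≡) = encode-injective d c (trans d≡ em≡)
    ... | no none      = ⊥-elim (none (c , sym em≡))

  Generic : Pt → Set₁
  Generic z = K z × ∀ c → Obeys c z

  generic : ∀ z → K z → (∀ m → ∃[ g ] g ∈ᶠ z × Forces (code m) g) → Generic z
  generic z z∈K forced = z∈K , obeys
    where
    obeys : ∀ c → Obeys c z
    obeys c with m , refl ← code-onto c with g , g∈z , forces ← forced m = forces z z∈K g∈z

  -- Obeying the codes `within` is exactly what `fusion` asks for in the possibility set of `z`.
  forcing-dense-within : ∀ j z → Generic z → ∀ m {h} → Possible (theory-of-knowledge j z) h →
    ∃[ x ] Possible (theory-of-knowledge j z) (h ∧ x) × Forces (code m) (h ∧ x)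
  forcing-dense-within j z (_ , obeys) m {h} possible-h with obeys (within j h (code m))
  ... | inj₁ k∈z = ⊥-elim (possible-h k∈z)
  ... | inj₂ (s , forces , ◇hs) = s , ∉-~ z ◇hs , forces

  opaque
    generic-neighbour : ∀ j {h} z → Generic z → ◇ j h ∈ᶠ z → Σ[ y ∈ Pt ] 𝒬-equiv j z y × h ∈ᶠ y × Generic y
    generic-neighbour j {h} z gen@(z∈K , _) ◇h∈z
      with y , z⊆y , h∈y , forced ← fusion (theory-of-knowledge j z) (λ m → Forces (code m))
                                     (forcing-dense-within j z gen) (∉-~ z ◇h∈z) =
        y , knowledge⇒≈ z y z⊆y , h∈y , generic y (Ck-≈ f z y z∈K (knowledge⇒≈ z y z⊆y)) forced

    generic-reach : ∀ w {h} z → Generic z → ¬ □ w (~ h) ∈ᶠ z → Σ[ y ∈ Pt ] Reach w z y × h ∈ᶠ y × Generic y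
    generic-reach [] {h} z gen ∉z = z , reach-refl z , ∈-apply z (double-negation h) (∈-~ z ∉z) , gen
    generic-reach (j ∷ w) {h} z gen ∉z
      with y , z≈y , h∈y , gen′ ← generic-neighbour j {~ □ w (~ h)} z gen
             (∈-~ z λ k∈z → ∉z (k-mono z (λ v → ∈-apply v (double-negation _)) k∈z))
      with x , r , h∈x , gen″ ← generic-reach w y gen′ (∉-~ y h∈y) = x , step z≈y r , h∈x , gen″

    generic-dense : ∀ z → Generic z → ∀ {h} → Meets h → Σ[ y ∈ Pt ] Cell z y × h ∈ᶠ y × Generic y
    generic-dense z gen {h} m with w , ∉z ← lower (proj₂ gen (visits h)) m
      with y , r , h∈y , gen′ ← generic-reach w z gen ∉z = y , (w , r) , h∈y , gen′

  reach-Ck : ∀ {w} {x y : Pt} → K x → Reach w x y → K y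
  reach-Ck x∈K (stop x⊆y) i = x⊆y (x∈K i)
  reach-Ck x∈K (step {x = x} {z} x≈z r) = reach-Ck (Ck-≈ f x z x∈K x≈z) r

  generic-cell : ∀ z → Generic z → IsDenseCell f (Cell z)
  generic-cell z gen = cell-isCell fzero z , (λ (_ , r) → reach-Ck (proj₁ gen) r) , dense
    where
    dense : ∀ U → IsOpen U → _ → _
    dense U open-U (x , x∈U , x∈K)
      with g , g∈x , g⊆U ← open-U x∈U
      with y , y∈cell , g∈y , y∈K , _ ← generic-dense z gen (meets x x∈K g∈x) =
        y , (g⊆U g∈y , y∈K) , y∈cell

  generic-splits : ∀ j z → Generic z → ∀ {h} → Possible (theory-of-knowledge j z) h →
    ∃[ s ] Possible (theory-of-knowledge j z) (h ∧ s) × Possible (theory-of-knowledge j z) (h ∧ ~ s)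
  generic-splits j z (_ , obeys) {h} possible-h with lower (obeys (splits j h))
  ... | inj₁ k∈z = ⊥-elim (possible-h k∈z)
  ... | inj₂ (s , ◇hs , ◇h~s) = s , ∉-~ z ◇hs , ∉-~ z ◇h~s

-- Closed sets without isolated points

module PerfectSet (em : ∀ {ℓ} → ExcludedMiddle ℓ) {X J : Set}
                  (e : ℕ → Formula X J) (e-onto : ∀ g → ∃[ i ] e i ≡ g)
                  (T : Theory X J)
                  (splitting : ∀ {h} → Possible T h → ∃[ s ] Possible T (h ∧ s) × Possible T (h ∧ ~ s))
                  {h₀ : Formula X J} (possible-h₀ : Possible T h₀) where

  open Classical em e e-onto
  open Theory T using (set) renaming (theorem to thm; detach to _·_)

  private
    F′ = Formula X J
    Pt = Ω X J

  least : (P : ℕ → Set) → ∃ P → ∃[ i ] P i × (∀ m → m < i → ¬ P m)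
  least P (n , Pn) = [ id , (λ none → ⊥-elim (none n ≤-refl Pn)) ]′ (search (suc n))
    where
    search : ∀ n → (∃[ i ] P i × (∀ m → m < i → ¬ P m)) ⊎ (∀ m → m < n → ¬ P m)
    search zero    = inj₂ λ _ ()
    search (suc n) with search n | em {P = P n}
    ... | inj₁ found | _      = inj₁ found
    ... | inj₂ none  | yes Pn = inj₁ (n , Pn , none)
    ... | inj₂ none  | no ¬Pn = inj₂ λ m m<1+n → [ none m , (λ { refl → ¬Pn }) ]′ (m≤n⇒m<n∨m≡n (≤-pred m<1+n))

  possible-⊆ : ∀ {g h} → (∀ z → T ⊆Ω z → g ∈ᶠ z → h ∈ᶠ z) → Possible T g → Possible T h
  possible-⊆ g⊆h possible-g with z , T⊆z , g∈z ← lindenbaum T possible-g =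
    possible T z T⊆z (g⊆h z T⊆z g∈z)

  Splits : F′ → ℕ → Set
  Splits h i = Possible T (h ∧ e i) × Possible T (h ∧ ~ e i)

  splits-∧ : ∀ {h g i} → Splits (h ∧ g) i → Splits h i
  splits-∧ (p , q) = possible-⊆ (λ z _ → weaken z) p , possible-⊆ (λ z _ → weaken z) q
    where
    weaken : ∀ {h g c} (z : Pt) → (h ∧ g) ∧ c ∈ᶠ z → h ∧ c ∈ᶠ z
    weaken z m = ∈-∧ z (∈-∧ˡ z (∈-∧ˡ z m)) (∈-∧ʳ z m)

  State : Set
  State = ∃ (Possible T)

  opaque
    -- Branching at the least formula that is still undecided ensures that every formula is decided
    -- along every branch.
    least-split : ∀ (s : State) → ∃[ i ] Splits (proj₁ s) i × (∀ m → m < i → ¬ Splits (proj₁ s) m)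
    least-split (h , possible-h) with s , both ← splitting possible-h with i , refl ← e-onto s =
      least (Splits h) (i , both)

  index : State → ℕ
  index s = proj₁ (least-split s)

  index-splits : ∀ s → Splits (proj₁ s) (index s)
  index-splits s = proj₁ (proj₂ (least-split s))

  descend-to : State → Bool → State
  descend-to s true  = proj₁ s ∧ e (index s) , proj₁ (index-splits s)
  descend-to s false = proj₁ s ∧ ~ e (index s) , proj₂ (index-splits s)

  path : (ℕ → Bool) → ℕ → State
  path a zero    = h₀ , possible-h₀
  path a (suc n) = descend-to (path a n) (a n)

  descend-splits : ∀ s c {i} → Splits (proj₁ (descend-to s c)) i → Splits (proj₁ s) i
  descend-splits s true  = splits-∧
  descend-splits s false = splits-∧

  descend-decides : ∀ s c → ¬ Splits (proj₁ (descend-to s c)) (index s)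
  descend-decides s true (_ , possible-e~e) with z , _ , m ← lindenbaum T possible-e~e =
    ∉-~ z (∈-∧ʳ z m) (∈-∧ʳ z (∈-∧ˡ z m))
  descend-decides s false (possible-~ee , _) with z , _ , m ← lindenbaum T possible-~ee =
    ∉-~ z (∈-∧ʳ z (∈-∧ˡ z m)) (∈-∧ʳ z m)

  -- The index of the first splitting formula strictly increases along a path.
  settled : ∀ a n m → m < n → ¬ Splits (proj₁ (path a n)) m
  settled a (suc n) m m<1+n splits with <-cmp m (index (path a n))
  ... | tri< m<i _ _  = proj₂ (proj₂ (least-split (path a n))) m m<i (descend-splits (path a n) (a n) splits)
  ... | tri≈ _ refl _ = descend-decides (path a n) (a n) splits
  ... | tri> _ _ i<m  = settled a n (index (path a n)) (<-≤-trans i<m (≤-pred m<1+n)) (index-splits (path a n))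

  ¬splits⇒decides : ∀ {h i} → ¬ Splits h i → Decides T h (e i)
  ¬splits⇒decides {h} {i} ¬splits with em {P = Possible T (h ∧ e i)}
  ... | no ¬p = inj₂ (thm (exclusion⁻ _ _) · decidable-stable em ¬p)
  ... | yes p = inj₁ (thm (exclusion⁺ _ _) · decidable-stable em (λ q → ¬splits (p , q)))

  path-descends : ∀ a → Descending T (λ n → proj₁ (path a n))
  path-descends a n with a n
  ... | true  = thm (projectionˡ _ _)
  ... | false = thm (projectionˡ _ _)

  opaque
    branch : ∀ a → Σ[ z ∈ Pt ] T ⊆Ω z × (∀ n → proj₁ (path a n) ∈ᶠ z) ×
                     (∀ {g} → g ∈ᶠ z → ∃[ n ] set (proj₁ (path a n) ⇒ g))
    branch a = limit T (λ n → proj₁ (path a n)) (path-descends a) (λ n → proj₂ (path a n))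
                 (λ n → ¬splits⇒decides (settled a (suc n) n ≤-refl))

  point : (ℕ → Bool) → Pt
  point a = proj₁ (branch a)

  T⊆point : ∀ a → T ⊆Ω point a
  T⊆point a = proj₁ (proj₂ (branch a))

  path-∈ : ∀ a n → proj₁ (path a n) ∈ᶠ point a
  path-∈ a = proj₁ (proj₂ (proj₂ (branch a)))

  point-⊆ : ∀ a (y : Pt) → T ⊆Ω y → (∀ n → proj₁ (path a n) ∈ᶠ y) → ∀ {g} → g ∈ᶠ point a → g ∈ᶠ y
  point-⊆ a y T⊆y path∈y g∈ with n , h⇒g ← proj₂ (proj₂ (proj₂ (branch a))) g∈ =
    ∈-detach y (T⊆y h⇒g) (path∈y n)

  path-cong : ∀ {a b} → (∀ n → a n ≡ b n) → ∀ n → path a n ≡ path b n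
  path-cong a≗b zero    = refl
  path-cong a≗b (suc n) = cong₂ descend-to (path-cong a≗b n) (a≗b n)

  point-cong : ∀ {a b} → (∀ n → a n ≡ b n) → ∀ {g} → g ∈ᶠ point a → g ∈ᶠ point b
  point-cong {a} {b} a≗b = point-⊆ a (point b) (T⊆point b) λ n →
    subst (λ s → proj₁ s ∈ᶠ point b) (sym (path-cong a≗b n)) (path-∈ b n)

  descend-injective : ∀ s c d (z : Pt) → proj₁ (descend-to s c) ∈ᶠ z → proj₁ (descend-to s d) ∈ᶠ z → c ≡ d
  descend-injective s true  true  z _ _ = refl
  descend-injective s false false z _ _ = refl
  descend-injective s true  false z m m′ = ⊥-elim (∉-~ z (∈-∧ʳ z m′) (∈-∧ʳ z m))
  descend-injective s false true  z m m′ = ⊥-elim (∉-~ z (∈-∧ʳ z m) (∈-∧ʳ z m′))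

  -- The two successors of a state contradict each other, so a point determines its branch.
  path-unique : ∀ a b (z : Pt) → (∀ n → proj₁ (path a n) ∈ᶠ z) → (∀ n → proj₁ (path b n) ∈ᶠ z) →
                ∀ n → path a n ≡ path b n × a n ≡ b n
  path-unique a b z a∈ b∈ n = same n , bit n (same n)
    where
    bit : ∀ n → path a n ≡ path b n → a n ≡ b n
    bit n eq = descend-injective (path a n) (a n) (b n) z (a∈ (suc n))
                 (subst (λ s → proj₁ (descend-to s (b n)) ∈ᶠ z) (sym eq) (b∈ (suc n)))
    same : ∀ n → path a n ≡ path b n
    same zero    = refl
    same (suc n) = cong₂ descend-to (same n) (bit n (same n))

  choice : Pt → State → Bool
  choice y s = does (e (index s) ∈? y)

  trace : Pt → ℕ → State
  trace y zero    = h₀ , possible-h₀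
  trace y (suc n) = descend-to (trace y n) (choice y (trace y n))

  address : Pt → ℕ → Bool
  address y n = choice y (trace y n)

  path-address : ∀ y n → path (address y) n ≡ trace y n
  path-address y zero    = refl
  path-address y (suc n) = cong (λ s → descend-to s (address y n)) (path-address y n)

  trace-∈ : ∀ y → h₀ ∈ᶠ y → ∀ n → proj₁ (trace y n) ∈ᶠ y
  trace-∈ y h₀∈y zero = h₀∈y
  trace-∈ y h₀∈y (suc n) with e (index (trace y n)) ∈? y
  ... | yes e∈y = ∈-∧ y (trace-∈ y h₀∈y n) e∈y
  ... | no  e∉y = ∈-∧ y (trace-∈ y h₀∈y n) (∈-~ y e∉y)

  point-address : ∀ y → T ⊆Ω y → h₀ ∈ᶠ y → ∀ {g} → g ∈ᶠ point (address y) → g ∈ᶠ y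
  point-address y T⊆y h₀∈y = point-⊆ (address y) y T⊆y λ n →
    subst (λ s → proj₁ s ∈ᶠ y) (sym (path-address y n)) (trace-∈ y h₀∈y n)

  -- The hypotheses make `P` the closed set of `T`. Each of its points lies on the branch following
  -- its own choices, and a branch contains only one point.
  cardinality : ∀ {P : Pred Pt ℓ} → (∀ {y} → P y → T ⊆Ω y × h₀ ∈ᶠ y) →
                (∀ {y} → T ⊆Ω y → P y) → HasCardinalityOfContinuum (Subsetoid (Ω-setoid X J) P)
  cardinality {P = P} P⇒ ⇒P = record
    { to        = λ a → point a , ⇒P (T⊆point a)
    ; cong      = λ a≗b → point-cong a≗b , point-cong (λ n → sym (a≗b n))
    ; bijective = injective , surjective
    }
    where
    injective : ∀ {a b} → (Ω.set (point a) ≐ Ω.set (point b)) → ∀ n → a n ≡ b n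
    injective {a} {b} (a⊆b , _) n =
      proj₂ (path-unique a b (point b) (λ n → a⊆b (path-∈ a n)) (path-∈ b) n)
    surjective : ∀ ((y , _) : Σ Pt P) → ∃[ a ] (∀ {b} → (∀ n → b n ≡ a n) → Ω.set (point b) ≐ Ω.set y)
    surjective (y , y∈P) = address y , λ {b} b≗ →
      let y⊇ : ∀ {g} → g ∈ᶠ point b → g ∈ᶠ y
          y⊇ g∈ = point-address y (proj₁ (P⇒ y∈P)) (proj₂ (P⇒ y∈P)) (point-cong b≗ g∈)
      in y⊇ , ∉-⊆ {z = point b} {y} y⊇

-- The continuum of cells

module CantorScheme (em : ∀ {ℓ} → ExcludedMiddle ℓ) {X : Set} {n : ℕ}
                    (e : ℕ → Formula X (Fin (suc n))) (e-onto : ∀ g → ∃[ i ] e i ≡ g)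
                    (f : Formula X (Fin (suc n)))
                    (another : ∀ (j : Fin (suc n)) → ∃[ b ] b ≢ j)
                    (C C′ : Subset) (dense-C : IsDenseCell f C) (dense-C′ : IsDenseCell f C′)
                    (C≢C′ : ¬ C ≐ C′) where

  open Classical em e e-onto
  open CommonKnowledge em e e-onto f
  open Reachability em e e-onto
  open DenseCells em e e-onto f another C C′ dense-C dense-C′ C≢C′

  private
    J′ = Fin (suc n)
    F′ = Formula X J′
    Pt = Ω X J′
    K  = Ck f

  -- Words of agents are enumerated as the outermost knowledge operators of formulas; `~ e 0` marks
  -- the end of a word.
  wordOf : F′ → List J′
  wordOf (k j g) = j ∷ wordOf g
  wordOf _       = []

  spell : List J′ → F′
  spell []      = ~ e 0
  spell (j ∷ w) = k j (spell w)

  wordOf-spell : ∀ w → wordOf (spell w) ≡ w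
  wordOf-spell []      = refl
  wordOf-spell (j ∷ w) = cong (j ∷_) (wordOf-spell w)

  word : ℕ → List J′
  word i = wordOf (e i)

  word-onto : ∀ w → ∃[ i ] word i ≡ w
  word-onto w with i , eq ← e-onto (spell w) = i , trans (cong wordOf eq) (wordOf-spell w)

  infix 4 _⊑_
  _⊑_ : F′ → F′ → Set₁
  g ⊑ h = ∀ z → g ∈ᶠ z → h ∈ᶠ z

  module _ {A : Set} (_≟ᴬ_ : DecidableEquality A) where

    -- Distinctness is a premise inside the property, so that all triples of a product list can be
    -- treated alike.
    Separated : (A → F′) → A × A × ℕ → Set₁
    Separated H (s , t , i) = s ≢ t → ∀ z → H s ∈ᶠ z → □ (word i) (~ H t) ∈ᶠ z

    -- Shrinking preserves separation, so the pairs can be handled one after another.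
    separated-⊑ : ∀ {G H} → (∀ s → G s ⊑ H s) → ∀ x → Separated H x → Separated G x
    separated-⊑ G⊑H (s , t , i) sep s≢t z Gs∈z = □-mono (word i) z
      (λ y ~Ht∈y → ∈-~ y λ Gt∈y → ∉-~ y ~Ht∈y (G⊑H t y Gt∈y)) (sep s≢t z (G⊑H s z Gs∈z))

    separate-pair : (H : A → F′) → (∀ s → Meets (H s)) → ∀ x →
                    Σ[ G ∈ (A → F′) ] (∀ s → Meets (G s)) × (∀ s → G s ⊑ H s) × Separated G x
    separate-pair H meets-H (s , t , i) with s ≟ᴬ t
    ... | yes s≡t = H , meets-H , (λ _ _ m → m) , λ s≢t → ⊥-elim (s≢t s≡t)
    ... | no  s≢t with x , y , meets-x , meets-y , sep ← separating (word i) (meets-H s) (meets-H t) =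
        (λ u → proj₁ (choose u))
      , (λ u → proj₁ (proj₂ (choose u)))
      , (λ u → proj₁ (proj₂ (proj₂ (choose u))))
      , λ _ z Gs∈z → □-mono (word i) z
          (λ v ~y∈v → ∈-~ v λ Gt∈v → ∉-~ v ~y∈v (proj₂ (proj₂ (proj₂ (proj₂ (choose t)))) refl v Gt∈v))
          (sep z (proj₁ (proj₂ (proj₂ (proj₂ (choose s)))) refl z Gs∈z))
      where
      choose : ∀ u → ∃[ g ] Meets g × g ⊑ H u × (u ≡ s → g ⊑ x) × (u ≡ t → g ⊑ y)
      choose u with u ≟ᴬ s | u ≟ᴬ t
      ... | yes refl | _        = H s ∧ x , meets-x , (λ z → ∈-∧ˡ z) , (λ _ z → ∈-∧ʳ z) , λ s≡t → ⊥-elim (s≢t s≡t)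
      ... | no u≢s   | yes refl = H t ∧ y , meets-y , (λ z → ∈-∧ˡ z) , (λ t≡s → ⊥-elim (u≢s t≡s)) , λ _ z → ∈-∧ʳ z
      ... | no u≢s   | no u≢t   = H u , meets-H u , (λ _ m → m) , (λ u≡s → ⊥-elim (u≢s u≡s)) , λ u≡t → ⊥-elim (u≢t u≡t)

    separate-all : ∀ xs (H : A → F′) → (∀ s → Meets (H s)) →
                   Σ[ G ∈ (A → F′) ] (∀ s → Meets (G s)) × (∀ s → G s ⊑ H s) × All (Separated G) xs
    separate-all []       H meets-H = H , meets-H , (λ _ _ m → m) , []
    separate-all (x ∷ xs) H meets-H
      with H′ , meets-H′ , H′⊑H , sep ← separate-pair H meets-H x
      with G , meets-G , G⊑H′ , seps ← separate-all xs H′ meets-H′ =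
      G , meets-G , (λ s z m → H′⊑H s z (G⊑H′ s z m)) , separated-⊑ G⊑H′ x sep ∷ seps

  Node : ℕ → Set
  Node = Vec Bool

  nodes : ∀ m → List (Node m)
  nodes zero    = [] ∷ []
  nodes (suc m) = map (true ∷_) (nodes m) ++ map (false ∷_) (nodes m)

  ∈-nodes : ∀ {m} (s : Node m) → s ∈ˡ nodes m
  ∈-nodes []          = here refl
  ∈-nodes (true  ∷ s) = ∈-++⁺ˡ (∈-map⁺ (true ∷_) (∈-nodes s))
  ∈-nodes (false ∷ s) = ∈-++⁺ʳ _ (∈-map⁺ (false ∷_) (∈-nodes s))

  Stage : ℕ → Set
  Stage m = Σ[ H ∈ (Node m → F′) ] (∀ s → Meets (H s))

  -- `decides` makes branches converge to points, `forces` makes these points generic, and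
  -- `separates` puts different branches into different cells, each level treating one more word.
  record Refines (m : ℕ) (L : Stage m) (L′ : Stage (suc m)) : Set₁ where
    private
      H  = proj₁ L
      H′ = proj₁ L′
    field
      below     : ∀ b s → H′ (b ∷ s) ⊑ H s
      decides   : ∀ s → Decides common-knowledge (H′ s) (e m)
      forces    : ∀ s → Forces (code m) (H′ s)
      separates : ∀ s t → s ≢ t → ∀ i → i < suc m → ∀ z → H′ s ∈ᶠ z → □ (word i) (~ H′ t) ∈ᶠ z

  decides-⊑ : ∀ {g h c} → g ⊑ h → Decides common-knowledge h c → Decides common-knowledge g c
  decides-⊑ g⊑h (inj₁ h⇒c)  = inj₁ (entailed common-knowledge λ z T⊆z → ∈-⇒ z λ g∈z → ∈-detach z (T⊆z h⇒c) (g⊑h z g∈z))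
  decides-⊑ g⊑h (inj₂ h⇒~c) = inj₂ (entailed common-knowledge λ z T⊆z → ∈-⇒ z λ g∈z → ∈-detach z (T⊆z h⇒~c) (g⊑h z g∈z))

  forces-⊑ : ∀ c {g h} → g ⊑ h → Forces c h → Forces c g
  forces-⊑ c g⊑h forces z z∈K g∈z = forces z z∈K (g⊑h z g∈z)

  pairs : ∀ m → List (Node (suc m) × Node (suc m) × ℕ)
  pairs m = cartesianProduct (nodes (suc m)) (cartesianProduct (nodes (suc m)) (upTo (suc m)))

  opaque
    refine-node : ∀ m {h} → Meets h →
                  ∃[ g ] Meets g × g ⊑ h × Decides common-knowledge g (e m) × Forces (code m) g
    refine-node m {h} meets-h
      with x , meets-hx , decides ← decide common-knowledge (e m) meets-h
      with y , meets-hxy , forces ← forcing-dense (code m) meets-hx =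
        ((h ∧ x) ∧ y) , meets-hxy , (λ z g∈z → ∈-∧ˡ z (∈-∧ˡ z g∈z))
      , decides-⊑ (λ z → ∈-∧ˡ z) decides , forces

    refine : ∀ m (L : Stage m) → Σ[ L′ ∈ Stage (suc m) ] Refines m L L′
    refine m (H , meets-H)
      with G , meets-G , G⊑ , separated ← separate-all (≡-dec _≟ᵇ_) (pairs m)
             -- Both children of a node start from the same formula, which decides `e m` and forces
             -- `code m`. Separation then tells them apart, and shrinking loses neither property.
             (λ s → proj₁ (refine-node m (meets-H (tail s))))
             (λ s → proj₁ (proj₂ (refine-node m (meets-H (tail s))))) = (G , meets-G) , record
      { below     = λ b s z G∈z → proj₁ (proj₂ (proj₂ (refine-node m (meets-H s)))) z (G⊑ (b ∷ s) z G∈z)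
      ; decides   = λ s → decides-⊑ (G⊑ s) (proj₁ (proj₂ (proj₂ (proj₂ (refine-node m (meets-H (tail s)))))))
      ; forces    = λ s → forces-⊑ (code m) (G⊑ s) (proj₂ (proj₂ (proj₂ (proj₂ (refine-node m (meets-H (tail s)))))))
      ; separates = λ s t s≢t i i≤m z → All.lookup separated
          (∈-cartesianProduct⁺ (∈-nodes s) (∈-cartesianProduct⁺ (∈-nodes t) (∈-upTo⁺ i≤m))) s≢t z
      }

  meets-top : Meets (e 0 ⇒ e 0)
  meets-top with (x , x∈C) , _ ← proj₁ dense-C =
    meets x (proj₁ (proj₂ dense-C) x∈C) (∈-theorem x (identity (e 0)))

  tree : ∀ m → Stage m
  tree zero    = (λ _ → e 0 ⇒ e 0) , (λ _ → meets-top)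
  tree (suc m) = proj₁ (refine m (tree m))

  refines : ∀ m → Refines m (tree m) (tree (suc m))
  refines m = proj₂ (refine m (tree m))

  -- Nodes list the bits in reverse order, the newest first.
  prefix : (ℕ → Bool) → ∀ m → Node m
  prefix a zero    = []
  prefix a (suc m) = a m ∷ prefix a m

  prefix-injective : ∀ a b m → prefix a m ≡ prefix b m → ∀ i → i < m → a i ≡ b i
  prefix-injective a b (suc m) eq i i<1+m with m≤n⇒m<n∨m≡n (≤-pred i<1+m) | ∷-injective eq
  ... | inj₁ i<m  | _ , eq′ = prefix-injective a b m eq′ i i<m
  ... | inj₂ refl | eq₀ , _ = eq₀

  prefix-cong : ∀ {a b : ℕ → Bool} → (∀ m → a m ≡ b m) → ∀ m → prefix a m ≡ prefix b m
  prefix-cong a≗b zero    = refl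
  prefix-cong a≗b (suc m) = cong₂ _∷_ (a≗b m) (prefix-cong a≗b m)

  node-at : (ℕ → Bool) → ℕ → F′
  node-at a m = proj₁ (tree m) (prefix a m)

  opaque
    branch : ∀ a → Σ[ z ∈ Pt ] common-knowledge ⊆Ω z × (∀ m → node-at a m ∈ᶠ z) ×
                     (∀ {g} → g ∈ᶠ z → ∃[ m ] Theory.set common-knowledge (node-at a m ⇒ g))
    branch a = limit common-knowledge (node-at a)
      (λ m → Theory.theorem common-knowledge (completeness λ z → ∈-⇒ z (Refines.below (refines m) (a m) (prefix a m) z)))
      (λ m → proj₂ (tree m) (prefix a m))
      (λ m → Refines.decides (refines m) (prefix a (suc m)))

  point : (ℕ → Bool) → Pt
  point a = proj₁ (branch a)

  node-at-∈ : ∀ a m → node-at a m ∈ᶠ point a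
  node-at-∈ a = proj₁ (proj₂ (proj₂ (branch a)))

  point-generic : ∀ a → Generic (point a)
  point-generic a = generic (point a) (⊆Ω⇒Ck (point a) (proj₁ (proj₂ (branch a)))) λ m →
    node-at a (suc m) , node-at-∈ a (suc m) , Refines.forces (refines m) (prefix a (suc m))

  point-cong : ∀ {a b} → (∀ m → a m ≡ b m) → ∀ {g} → g ∈ᶠ point a → g ∈ᶠ point b
  point-cong {a} {b} a≗b g∈ with m , h⇒g ← proj₂ (proj₂ (proj₂ (branch a))) g∈ =
    ∈-detach (point b) (proj₁ (proj₂ (branch b)) h⇒g)
      (subst (λ s → proj₁ (tree m) s ∈ᶠ point b) (sym (prefix-cong a≗b m)) (node-at-∈ b m))

  point-unreachable : ∀ a b m → a m ≢ b m → ∀ w → ¬ Reach w (point a) (point b)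
  point-unreachable a b m a≢b w r = unreachable-by (proj₁ (word-onto w))
      (subst (λ w → Reach w (point a) (point b)) (sym (proj₂ (word-onto w))) r)
    where
    unreachable-by : ∀ i → ¬ Reach (word i) (point a) (point b)
    unreachable-by i r = ∉-~ (point b) (□-reach separated r) (node-at-∈ b N)
      where
      -- This level is past bit `m`, so the prefixes differ, and past word `i`, so that word has
      -- been treated.
      N = suc (i + m)
      prefixes-differ : prefix a N ≢ prefix b N
      prefixes-differ eq = a≢b (prefix-injective a b N eq m (s≤s (m≤n+m m i)))
      separated : □ (word i) (~ node-at b N) ∈ᶠ point a
      separated = Refines.separates (refines (i + m)) (prefix a N) (prefix b N) prefixes-differ
                    i (s≤s (m≤m+n i m)) (point a) (node-at-∈ a N)

  cell-cong : ∀ {a b} → (∀ m → a m ≡ b m) → Cell (point a) ⊆ Cell (point b)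
  cell-cong {a} {b} a≗b (w , r) = w , reach-⊆ (point-cong (λ m → sym (a≗b m))) r

  𝒞 : Pred (Subset {X} {J′}) (lsuc 0ℓ)
  𝒞 D = ∃[ a ] D ≐ Cell (point a)

  𝒞-cardinality : HasCardinalityOfContinuum (Subsetoid SubsetSetoid 𝒞)
  𝒞-cardinality = record
    { to        = λ a → Cell (point a) , a , id , id
    ; cong      = λ {a} {b} a≗b → cell-cong a≗b , cell-cong (λ m → sym (a≗b m))
    ; bijective = injective , λ (D , a , D⊆ , ⊆D) → a , λ b≗a →
        (λ y∈ → ⊆D (cell-cong b≗a y∈)) , λ y∈ → cell-cong (λ m → sym (b≗a m)) (D⊆ y∈)
    }
    where
    injective : ∀ {a b} → Cell (point a) ≐ Cell (point b) → ∀ m → a m ≡ b m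
    injective {a} {b} (_ , b⊆a) m with a m ≟ᵇ b m
    ... | yes eq = eq
    ... | no a≢b with w , r ← b⊆a ([] , reach-refl (point b)) = ⊥-elim (point-unreachable a b m a≢b w r)

  module _ {z : Pt} (generic-z : Generic z) where

    Region : Set
    Region = ∃ Meets

    -- Each region shrinks to a part where agent `fzero` knows some formula, and a generic point of
    -- the rest, where it is not known, becomes a centre. All later centres share that knowledge, so
    -- no two centres are `fzero`-equivalent.
    smaller : Region → Region
    smaller (r , meets-r) with c , meets-k , _ ← splitting-knowledge fzero meets-r = r ∧ k fzero c , meets-k

    region : ℕ → Region
    region zero    = e 0 ⇒ e 0 , meets-top
    region (suc m) = smaller (region m)

    known : ℕ → F′
    known m = proj₁ (splitting-knowledge fzero (proj₂ (region m)))

    region-⊑ : ∀ {m m′} → m ≤′ m′ → proj₁ (region m′) ⊑ proj₁ (region m)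
    region-⊑ ≤′-refl        z r∈z = r∈z
    region-⊑ (≤′-step m≤m′) z r∈z = region-⊑ m≤m′ z (∈-∧ˡ z r∈z)

    opaque
      witness : ∀ m → Σ[ y ∈ Pt ] Cell z y × proj₁ (region m) ∧ ~ k fzero (known m) ∈ᶠ y × Generic y
      witness m = generic-dense z generic-z (proj₂ (proj₂ (splitting-knowledge fzero (proj₂ (region m)))))

    centre : ℕ → Pt
    centre m = proj₁ (witness m)

    centres-apart : ∀ {m m′} → m < m′ → ¬ 𝒬-equiv fzero (centre m) (centre m′)
    centres-apart {m} {m′} m<m′ (_ , ⊆m) =
      ∉-~ (centre m) (∈-∧ʳ (centre m) (proj₁ (proj₂ (proj₂ (witness m)))))
        (⊆m (∈-∧ʳ (centre m′) (region-⊑ (≤⇒≤′ m<m′) (centre m′)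
          (∈-∧ˡ (centre m′) (proj₁ (proj₂ (proj₂ (witness m′))))))))

    possibility : ℕ → Subset {X} {J′}
    possibility m y = Lift (lsuc 0ℓ) (𝒬-equiv fzero (centre m) y)

    infinitely-many : ∀ {D} → D ≐ Cell z → HasInfinitelyManyLargePossibilitySets D
    infinitely-many {D} (_ , cell⊆D) = record
      { to        = λ m → possibility m , inside m , (fzero , centre m , lower , lift) , large m
      ; cong      = λ { refl → id , id }
      ; injective = injective
      }
      where
      inside : ∀ m → possibility m ⊆ D
      inside m {y} (lift c≈y) with w , r ← proj₁ (proj₂ (witness m)) =
        cell⊆D (w ++ fzero ∷ [] , reach-trans r (reach-step (centre m) y c≈y))
      large : ∀ m → HasCardinalityOfContinuum (Subsetoid (Ω-setoid X J′) (possibility m))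
      -- The possibility set of a centre is the closed set of what `fzero` knows there, and it has
      -- no isolated points because the centre is generic.
      large m = PerfectSet.cardinality em e e-onto T (generic-splits fzero c (proj₂ (proj₂ (proj₂ (witness m)))))
                  {e 0 ⇒ e 0} (possible T c (λ kg∈c → ≈⇒knowledge c c (≈-refl fzero c) kg∈c) (∈-theorem c (identity (e 0))))
                  (λ { {y} (lift c≈y) → (λ kg∈c → ≈⇒knowledge c y c≈y kg∈c) , ∈-theorem y (identity (e 0)) })
                  (λ {y} T⊆y → lift (knowledge⇒≈ c y T⊆y))
        where
        c = centre m
        T = theory-of-knowledge fzero c
      injective : ∀ {m m′} → possibility m ≐ possibility m′ → m ≡ m′
      injective {m} {m′} (m⊆ , ⊆m) with <-cmp m m′
      ... | tri< m<m′ _ _ = ⊥-elim (centres-apart m<m′ (lower (⊆m {centre m′} (lift (≈-refl fzero (centre m′))))))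
      ... | tri≈ _ eq _   = eq
      ... | tri> _ _ m′<m = ⊥-elim (centres-apart m′<m (lower (m⊆ {centre m} (lift (≈-refl fzero (centre m))))))

  dense-cells : ∀ D → 𝒞 D → IsDenseCell f D × HasInfinitelyManyLargePossibilitySets D
  dense-cells D (a , D≐) = dense-D , infinitely-many (point-generic a) D≐
    where
    dense-cell : IsDenseCell f (Cell (point a))
    dense-cell = generic-cell (point a) (point-generic a)
    dense-D : IsDenseCell f D
    dense-D =
        ( (_ , proj₂ D≐ (proj₂ (proj₁ (proj₁ dense-cell))))
        , (λ j P P∈𝒬 (y , y∈P , y∈D) y∈ → proj₂ D≐ (proj₁ (proj₂ (proj₁ dense-cell)) j P P∈𝒬 (y , y∈P , proj₁ D≐ y∈D) y∈))
        , λ S sat saturated S⊆D y∈D → proj₂ (proj₂ (proj₁ dense-cell)) S sat saturated (λ s → proj₁ D≐ (S⊆D s)) (proj₁ D≐ y∈D))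
      , (λ y∈D → proj₁ (proj₂ dense-cell) (proj₁ D≐ y∈D))
      , λ U open-U hit → let y , y∈UK , y∈cell = proj₂ (proj₂ dense-cell) U open-U hit
                         in y , y∈UK , proj₂ D≐ y∈cell

-- Enumeration of the formulas

private
  -- The summand `a` is smaller than the gap from the square of `a + b` to the next square, so
  -- `a + b` and then `a` can be recovered.
  pair : ℕ → ℕ → ℕ
  pair a b = (a + b) * (a + b) + a

  pair-< : ∀ {a b c d} → a + b < c + d → pair a b < pair c d
  pair-< {a} {b} {c} {d} s<t = begin-strict
    s * s + a     ≤⟨ +-monoʳ-≤ (s * s) (m≤m+n a b) ⟩
    s * s + s     ≡⟨ +-comm (s * s) s ⟩
    s + s * s     <⟨ s≤s (m≤n+m (s + s * s) s) ⟩
    suc s + (s + s * s) ≡⟨ cong (suc s +_) (*-suc s s) ⟨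
    suc s * suc s ≤⟨ *-mono-≤ s<t s<t ⟩
    t * t         ≤⟨ m≤m+n (t * t) c ⟩
    t * t + c     ∎
    where
    open ≤-Reasoning
    s = a + b
    t = c + d

  pair-injective : ∀ a b c d → pair a b ≡ pair c d → a ≡ c × b ≡ d
  pair-injective a b c d eq with <-cmp (a + b) (c + d)
  ... | tri< s<t _ _ = ⊥-elim (<-irrefl eq (pair-< {a} {b} {c} {d} s<t))
  ... | tri> _ _ t<s = ⊥-elim (<-irrefl (sym eq) (pair-< {c} {d} {a} {b} t<s))
  ... | tri≈ _ s≡t _ with refl ← +-cancelˡ-≡ ((a + b) * (a + b)) a c
                          (trans eq (cong (λ t → t * t + c) (sym s≡t))) = refl , +-cancelˡ-≡ a b d s≡t

  number : ∀ {m n} → Formula (Fin m) (Fin n) → ℕ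
  number (atom x) = pair 0 (toℕ x)
  number (~ g)    = pair 1 (number g)
  number (g ∧ h)  = pair 2 (pair (number g) (number h))
  number (k j g)  = pair 3 (pair (toℕ j) (number g))

  tag : ∀ a b c d → pair a b ≡ pair c d → a ≡ c
  tag a b c d eq = proj₁ (pair-injective a b c d eq)

  body : ∀ a b d → pair a b ≡ pair a d → b ≡ d
  body a b d eq = proj₂ (pair-injective a b a d eq)

  number-injective : ∀ {m n} (g h : Formula (Fin m) (Fin n)) → number g ≡ number h → g ≡ h
  number-injective (atom x) (atom y) eq = cong atom (toℕ-injective (body 0 (toℕ x) (toℕ y) eq))
  number-injective (~ g)    (~ h)    eq = cong ~_ (number-injective g h (body 1 (number g) (number h) eq))
  number-injective (g ∧ g′) (h ∧ h′) eq = cong₂ _∧_ (number-injective g h (proj₁ eqs)) (number-injective g′ h′ (proj₂ eqs))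
    where
    eqs : number g ≡ number h × number g′ ≡ number h′
    eqs = pair-injective (number g) (number g′) (number h) (number h′)
            (body 2 (pair (number g) (number g′)) (pair (number h) (number h′)) eq)
  number-injective (k i g)  (k j h)  eq = cong₂ k (toℕ-injective (proj₁ eqs)) (number-injective g h (proj₂ eqs))
    where
    eqs : toℕ i ≡ toℕ j × number g ≡ number h
    eqs = pair-injective (toℕ i) (number g) (toℕ j) (number h)
            (body 3 (pair (toℕ i) (number g)) (pair (toℕ j) (number h)) eq)
  number-injective (atom x) (~ h)    eq with () ← tag 0 (toℕ x) 1 (number h) eq
  number-injective (atom x) (h ∧ h′) eq with () ← tag 0 (toℕ x) 2 (pair (number h) (number h′)) eq
  number-injective (atom x) (k j h)  eq with () ← tag 0 (toℕ x) 3 (pair (toℕ j) (number h)) eq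
  number-injective (~ g)    (atom y) eq with () ← tag 1 (number g) 0 (toℕ y) eq
  number-injective (~ g)    (h ∧ h′) eq with () ← tag 1 (number g) 2 (pair (number h) (number h′)) eq
  number-injective (~ g)    (k j h)  eq with () ← tag 1 (number g) 3 (pair (toℕ j) (number h)) eq
  number-injective (g ∧ g′) (atom y) eq with () ← tag 2 (pair (number g) (number g′)) 0 (toℕ y) eq
  number-injective (g ∧ g′) (~ h)    eq with () ← tag 2 (pair (number g) (number g′)) 1 (number h) eq
  number-injective (g ∧ g′) (k j h)  eq with () ← tag 2 (pair (number g) (number g′)) 3 (pair (toℕ j) (number h)) eq
  number-injective (k i g)  (atom y) eq with () ← tag 3 (pair (toℕ i) (number g)) 0 (toℕ y) eq
  number-injective (k i g)  (~ h)    eq with () ← tag 3 (pair (toℕ i) (number g)) 1 (number h) eq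
  number-injective (k i g)  (h ∧ h′) eq with () ← tag 3 (pair (toℕ i) (number g)) 2 (pair (number h) (number h′)) eq

-- Numbers of no formula are sent to `f`, since without atoms there may be no formula to serve as a
-- default.
enumeration : (∀ {ℓ} → ExcludedMiddle ℓ) → ∀ {m n} → Formula (Fin m) (Fin n) →
              Σ[ e ∈ (ℕ → Formula (Fin m) (Fin n)) ] (∀ g → ∃[ i ] e i ≡ g)
enumeration em {m} {n} f = e , λ g → number g , e-number g
  where
  decode : ∀ i → Dec (∃[ g ] number g ≡ i) → Formula (Fin m) (Fin n)
  decode i (yes (g , _)) = g
  decode i (no _)        = f
  e : ℕ → Formula (Fin m) (Fin n)
  e i = decode i em
  decode-number : ∀ g (d : Dec (∃[ h ] number h ≡ number g)) → decode (number g) d ≡ g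
  decode-number g (yes (h , eq)) = number-injective h g eq
  decode-number g (no none)      = ⊥-elim (none (g , refl))
  e-number : ∀ g → e (number g) ≡ g
  e-number g = decode-number g em

another-agent : ∀ {n} (j : Fin (suc (suc n))) → ∃[ b ] b ≢ j
another-agent fzero    = fsuc fzero , λ ()
another-agent (fsuc j) = fzero , λ ()

theorem1 : (∀ {ℓ} → ExcludedMiddle ℓ) →
    ∀ {m n} (f : Formula (Fin m) (Fin n)) → Generative f →
    Σ[ 𝒞 ∈ Pred (Subset {Fin m} {Fin n}) (lsuc 0ℓ) ]
    (HasCardinalityOfContinuum (Subsetoid SubsetSetoid 𝒞)
    × (∀ C → C ∈ 𝒞 → IsDenseCell f C × HasInfinitelyManyLargePossibilitySets C))
theorem1 em {n = suc (suc n)} f generative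
  with C , C′ , dense-C , dense-C′ , C≢C′ ← Generative.many-dense-cells generative
  with e , e-onto ← enumeration em f = 𝒞 , 𝒞-cardinality , dense-cells
  where open CantorScheme em e e-onto f another-agent C C′ dense-C dense-C′ C≢C′
theorem1 em {n = suc zero} f generative with s≤s () ← Generative.two-agents generative
theorem1 em {n = zero} f generative with () ← Generative.two-agents generative
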